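{- Let $r,t$ be integers with $r\geq 3$ and $t$ even. Then $$\operatorname{gr}_4(P_5:S_t^r)= \begin{cases} \frac{3t-4}{2}, & \text{if } 3\leq r\leq \left\lfloor\frac{t}{4}\right\rfloor;\\ t+2r-2, & \text{if } \left\lceil\frac{t}{4}\right\rceil\leq r\leq \frac{t-2}{2}. \end{cases}$$
   Context: All graphs are finite, simple and undirected. $K_n$ is the complete graph on $n$ vertices and $P_5$ is the path with $5$ vertices and $4$ edges. $S_t^r$ is the graph of order $t$ obtained from the star $K_{1,t-1}$ by adding $r$ pairwise independent edges between the leaves, so that it has $r$ triangles (sharing the center) and $t-2r-1$ pendent edges. A $k$-edge-coloring assigns to each edge one of $k$ colors; all $k$-edge-colorings are assumed exact, i.e. each of the $k$ colors is used at least once. An edge-colored graph is rainbow if all its edges have different colors and monochromatic if all its edges have a single color. A copy of a graph means a (not necessarily induced) subgraph isomorphic to it. For non-empty graphs $G,H$ (graphs with at least one edge) and a positive integer $k$, the Gallai-Ramsey number $\operatorname{gr}_k(G:H)$ is the minimum integer $N$ with $\binom{N}{2}\geq k$ (so that $K_N$ admits a $k$-edge-coloring) such that for all $n\geq N$, every $k$-edge-coloring of $K_n$ contains either a rainbow copy of $G$ or a monochromatic copy of $H$. -}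

module Defs where

open import Data.Fin using (Fin; toℕ)
open import Data.Fin.Properties using (any?)
open import Data.Nat using (ℕ; suc; NonZero; _+_; _*_; _∸_; _/_; _≤_; _<_)
open import Data.Nat.Combinatorics using (_C_)
open import Data.Nat.Properties using (_≟_; _<?_; <-irrefl; 1+n≢n)
open import Data.Product using (∃; ∃₂; _×_; _,_)
open import Data.Sum using (_⊎_; inj₁; inj₂; swap; reduce)
open import Function.Bundles using (_↣_; Injection)
open import Level using (0ℓ)
open import Relation.Binary.Core using (Rel)
open import Relation.Binary.Definitions using (Decidable; Symmetric)
open import Relation.Binary.PropositionalEquality using (_≡_; _≢_; sym; trans)
open import Relation.Nullary using (¬_)
open import Relation.Nullary.Decidable using (_×-dec_; _⊎-dec_)

⌈_/_⌉ : (m n : ℕ) .{{_ : NonZero n}} → ℕ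
⌈ m / n ⌉ = (m + (n ∸ 1)) / n

record Graph (n : ℕ) : Set₁ where
  field
    Adj    : Rel (Fin n) 0ℓ
    adj?   : Decidable Adj
    symm   : Symmetric Adj
    irrefl : ∀ i → ¬ Adj i i

-- The simple graph whose edges are the pairs related by E in at least one order.
fromEdges : ∀ {n} (E : Rel (Fin n) 0ℓ) → Decidable E → (∀ i → ¬ E i i) → Graph n
fromEdges E E? E-irrefl = record
  { Adj    = λ i j → E i j ⊎ E j i
  ; adj?   = λ i j → E? i j ⊎-dec E? j i
  ; symm   = swap
  ; irrefl = λ i e → E-irrefl i (reduce e)
  }

path : (n : ℕ) → Graph n
path n = fromEdges (λ i j → toℕ j ≡ suc (toℕ i))
                   (λ i j → toℕ j ≟ suc (toℕ i))
                   (λ i e → 1+n≢n (sym e))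

P₅ : Graph 5
P₅ = path 5

-- Vertex 0 is the center, and the r added edges are {1,2}, {3,4}, …, {2r-1,2r}.
-- This is the graph S_t^r whenever 2r + 1 ≤ t, the range in which S_t^r exists;
-- for smaller t, the added edges that do not fit are dropped.
StarEdge : (t r : ℕ) → Rel (Fin t) 0ℓ
StarEdge t r i j =
    (toℕ i ≡ 0 × 0 < toℕ j)
  ⊎ ∃ λ (m : Fin r) → toℕ i ≡ 1 + 2 * toℕ m × toℕ j ≡ 2 + 2 * toℕ m

starEdge? : (t r : ℕ) → Decidable (StarEdge t r)
starEdge? t r i j =
  ((toℕ i ≟ 0) ×-dec (0 <? toℕ j))
  ⊎-dec any? (λ m → (toℕ i ≟ 1 + 2 * toℕ m) ×-dec (toℕ j ≟ 2 + 2 * toℕ m))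

starEdge-irrefl : (t r : ℕ) (i : Fin t) → ¬ StarEdge t r i i
starEdge-irrefl t r i (inj₁ (i≡0 , 0<i))   = <-irrefl (sym i≡0) 0<i
starEdge-irrefl t r i (inj₂ (m , odd , ev)) = 1+n≢n (trans (sym ev) odd)

S : (t r : ℕ) → Graph t
S t r = fromEdges (StarEdge t r) (starEdge? t r) (starEdge-irrefl t r)

-- An exact k-edge-coloring of the complete graph on Fin n. The values of
-- colour on the diagonal are junk and are never consulted below.
record EdgeColoring (k n : ℕ) : Set where
  field
    colour     : Fin n → Fin n → Fin k
    colour-sym : ∀ i j → colour i j ≡ colour j i
    exact      : ∀ c → ∃₂ λ i j → i ≢ j × colour i j ≡ c

-- Copies need not be induced, so a copy of G in the complete graph on Fin n
-- is the image of an injection on vertices.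
module _ {k n m : ℕ} (χ : EdgeColoring k n) (G : Graph m) where
  open EdgeColoring χ
  open Graph G

  IsRainbow : Fin m ↣ Fin n → Set
  IsRainbow f = ∀ a b a′ b′ → Adj a b → Adj a′ b′ →
    colour (to a) (to b) ≡ colour (to a′) (to b′) →
    (a ≡ a′ × b ≡ b′) ⊎ (a ≡ b′ × b ≡ a′)
    where open Injection f using (to)

  IsMonochromatic : Fin m ↣ Fin n → Set
  IsMonochromatic f = ∃ λ c → ∀ a b → Adj a b → colour (to a) (to b) ≡ c
    where open Injection f using (to)

  HasRainbowCopy : Set
  HasRainbowCopy = ∃ IsRainbow

  HasMonochromaticCopy : Set
  HasMonochromaticCopy = ∃ IsMonochromatic

GallaiRamseyBound : ∀ {p q} → ℕ → Graph p → Graph q → ℕ → Set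
GallaiRamseyBound k G H N =
  k ≤ N C 2 ×
  (∀ n → N ≤ n → (χ : EdgeColoring k n) →
     HasRainbowCopy χ G ⊎ HasMonochromaticCopy χ H)

-- gr_k(G : H) = N, as a relation: N is the least Gallai-Ramsey bound.
IsGallaiRamseyNumber : ∀ {p q} → ℕ → Graph p → Graph q → ℕ → Set
IsGallaiRamseyNumber k G H N =
  GallaiRamseyBound k G H N ×
  (∀ N′ → GallaiRamseyBound k G H N′ → N ≤ N′)

{-# OPTIONS --safe #-}
module Submission where

-- Upper bound. Call a cherry a pair of adjacent edges of different colours. If two cherries use
-- disjoint pairs of colours, they yield a rainbow star K_{1,4}, a rainbow spider (K_{1,3} with one
-- edge subdivided) or a rainbow triangle with a pendant edge; without a rainbow P₅ the first two
-- contain the third, and then K_n minus the triangle is monochromatic. Otherwise some colour d is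
-- dominant: every vertex sees at most one other colour, so the vertices split into classes A, B, C
-- with only d across and only d and one other colour inside. Let |A| ≥ |B| ≥ |C| and take a centre
-- in C. Either A ∪ B contains r disjoint edges of colour d, or a maximal matching of colour d in A
-- leaves a clique of the other colour on at least t vertices.
--
-- Lower bound. Colour three classes by 1, 2, 3 inside and by 0 across. The class sizes are
-- t/2 - 1, t/2 - 1, t/2 - 1 in the first case and t - 1, r - 1, r - 1 in the second.
--
-- In both cases the claimed value is the maximum of (3t - 4)/2 and t + 2r - 2.

open import Defs
open import Data.Empty using (⊥; ⊥-elim)
open import Data.Fin using (Fin; zero; suc; toℕ; fromℕ<; inject₁; inject≤; punchOut; combine; remQuot; splitAt; _↑ˡ_; _↑ʳ_)
open import Data.Fin.Patterns
open import Data.Fin.Properties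
  using (any?; injective⇒≤; inject≤-injective; toℕ-inject≤; toℕ-inject₁; toℕ-injective; punchOut-injective)
import Data.Fin.Properties as Fin
open import Data.List using (List; []; _∷_; _++_; length; filter; allFin)
import Data.List as List
open import Data.List.Membership.Propositional.Properties using (∈-lookup)
open import Data.List.Properties using (length-++; length-tabulate; filter-all)
open import Data.List.Relation.Binary.Permutation.Propositional
  using (_↭_; prep; swap; ↭-sym; ↭-refl; ↭-trans; ↭⇒↭ₛ)
open import Data.List.Relation.Binary.Permutation.Propositional.Properties
  using (All-resp-↭; ↭-length; shift; ++⁺ʳ)
import Data.List.Relation.Binary.Permutation.Setoid.Properties as Permutationₛ
open import Data.List.Relation.Unary.All using (All; []; _∷_)
import Data.List.Relation.Unary.All as All
import Data.List.Relation.Unary.All.Properties as All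
open import Data.List.Relation.Unary.AllPairs using (AllPairs; []; _∷_)
import Data.List.Relation.Unary.AllPairs as AllPairs
open import Data.List.Relation.Unary.Any using (Any; here; there)
import Data.List.Relation.Unary.Any as Any
import Data.List.Relation.Unary.Any.Properties as Any
open import Data.List.Relation.Unary.Unique.Propositional using (Unique)
import Data.List.Relation.Unary.Unique.Propositional.Properties as Unique
open import Data.Maybe using (Maybe; just; nothing; map; from-just)
import Data.Maybe.Effectful as Maybe
open import Data.Nat using (ℕ; zero; suc; _+_; _*_; _∸_; _/_; ⌊_/2⌋; _≤_; _<_; z≤n; s≤s; z<s)
open import Data.Nat.Combinatorics using (_C_; nC1≡n; nCk+nC[k+1]≡[n+1]C[k+1])
open import Data.Nat.Divisibility using (_∣_; divides)
open import Data.Nat.DivMod using (m/n*n≤m; m*n/n≡m; /-monoˡ-≤)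
open import Data.Nat.Properties
open import Data.Nat.Tactic.RingSolver using (solve-∀)
open import Data.Product using (Σ; ∃; ∃₂; _×_; _,_; proj₁; proj₂)
open import Data.Product.Properties using (≡-dec)
open import Data.Sum using (_⊎_; inj₁; inj₂; [_,_]′)
open import Data.Vec using (Vec; []; _∷_; lookup)
import Data.Vec as Vec
open import Data.Vec.Relation.Unary.All using ([]; _∷_) renaming (All to Allᵛ)
open import Data.Vec.Relation.Unary.AllPairs using ([]; _∷_; allPairs?)
open import Data.Vec.Relation.Unary.Unique.Propositional using () renaming (Unique to Uniqueᵛ)
open import Data.Vec.Relation.Unary.Unique.Propositional.Properties using (map⁺; lookup-injective)
open import Function using (_∘_)
open import Function.Bundles using (_↔_; Injection; Inverse; mk↣; mk↔ₛ′)
open import Function.Definitions using (Injective)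
open import Level using (0ℓ)
open import Relation.Binary.Core using (Rel)
open import Relation.Binary.Definitions using (DecidableEquality; Symmetric)
open import Relation.Binary.PropositionalEquality
  using (_≡_; _≢_; refl; sym; trans; cong; cong₂; subst; setoid; ≢-sym; resp₂)
open import Relation.Nullary using (¬_; ¬?; Dec; yes; no)
open import Relation.Nullary.Decidable
  using (from-yes; True; toWitness; decidable-stable; _×-dec_; _⊎-dec_; _→-dec_)
open import Relation.Unary using (Decidable)

-- Indexing, permutations and sublists of lists

List-lookup-injective : ∀ {A : Set} {xs : List A} → Unique xs →
  ∀ i j → List.lookup xs i ≡ List.lookup xs j → i ≡ j
List-lookup-injective (_ ∷ _)  zero    zero    _  = refl
List-lookup-injective (x∉ ∷ _) zero    (suc j) eq = ⊥-elim (All.lookup x∉ (∈-lookup j) eq)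
List-lookup-injective (x∉ ∷ _) (suc i) zero    eq = ⊥-elim (All.lookup x∉ (∈-lookup i) (sym eq))
List-lookup-injective (_ ∷ u)  (suc i) (suc j) eq = cong suc (List-lookup-injective u i j eq)

AllPairs-resp-↭ : ∀ {A : Set} {R : Rel A 0ℓ} → Symmetric R → ∀ {xs ys} → xs ↭ ys →
  AllPairs R xs → AllPairs R ys
AllPairs-resp-↭ {A} {R} R-sym p = Permutationₛ.AllPairs-resp-↭ (setoid A) R-sym (resp₂ R) (↭⇒↭ₛ p)

Unique-resp-↭ : ∀ {A : Set} {xs ys : List A} → xs ↭ ys → Unique xs → Unique ys
Unique-resp-↭ = AllPairs-resp-↭ ≢-sym

AllPairs-++⁻ʳ : ∀ {A : Set} {R : Rel A 0ℓ} xs {ys} → AllPairs R (xs ++ ys) → AllPairs R ys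
AllPairs-++⁻ʳ []       K       = K
AllPairs-++⁻ʳ (_ ∷ xs) (_ ∷ K) = AllPairs-++⁻ʳ xs K

AllPairs-++⁻ˡ : ∀ {A : Set} {R : Rel A 0ℓ} xs {ys} → AllPairs R (xs ++ ys) → AllPairs R xs
AllPairs-++⁻ˡ []       _       = []
AllPairs-++⁻ˡ (_ ∷ xs) (a ∷ K) = All.++⁻ˡ xs a ∷ AllPairs-++⁻ˡ xs K

-- Copies of S_t^r

module Stars {k n : ℕ} (χ : EdgeColoring k n) where
  open EdgeColoring χ

  -- The matching is stored in the order of the list: its first `r` consecutive pairs have colour
  -- `c`, the tail is free. With a centre put in front, these pairs take the positions `1 + 2m` and
  -- `2 + 2m` that `StarEdge` joins.
  data Matched (c : Fin k) : ℕ → List (Fin n) → Set where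
    done : ∀ {L} → Matched c 0 L
    pair : ∀ {r x y L} → colour x y ≡ c → Matched c r L → Matched c (suc r) (x ∷ y ∷ L)

  Matched-lookup : ∀ {c r L} → Matched c r L → ∀ m → m < r → (i j : Fin (length L)) →
    toℕ i ≡ 2 * m → toℕ j ≡ suc (2 * m) → colour (List.lookup L i) (List.lookup L j) ≡ c
  Matched-lookup (pair e _)  zero    _         zero          (suc zero)    _  _  = e
  Matched-lookup (pair _ M) (suc m) (s≤s m<r) i j i≡ j≡
    rewrite *-suc 2 m with i | j
  ... | suc (suc i′) | suc (suc j′) =
    Matched-lookup M m m<r i′ j′ (suc-injective (suc-injective i≡)) (suc-injective (suc-injective j≡))
  ... | suc (suc i′) | zero     = ⊥-elim (0≢1+n j≡)
  ... | suc (suc i′) | suc zero = ⊥-elim (0≢1+n (suc-injective j≡))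
  ... | zero     | _ = ⊥-elim (0≢1+n i≡)
  ... | suc zero | _ = ⊥-elim (0≢1+n (suc-injective i≡))

  star-edge : ∀ {c v L r} → All (λ x → colour v x ≡ c) L → Matched c r L →
    (i j : Fin (length (v ∷ L))) →
    (toℕ i ≡ 0 × 0 < toℕ j) ⊎ (∃ λ (m : Fin r) → toℕ i ≡ 1 + 2 * toℕ m × toℕ j ≡ 2 + 2 * toℕ m) →
    colour (List.lookup (v ∷ L) i) (List.lookup (v ∷ L) j) ≡ c
  star-edge v~ M zero    (suc j) (inj₁ _)              = All.lookup v~ (∈-lookup j)
  star-edge v~ M (suc i) (suc j) (inj₂ (m , i≡ , j≡)) =
    Matched-lookup M (toℕ m) (Fin.toℕ<n m) i j (suc-injective i≡) (suc-injective j≡)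

  -- The list may be longer than `t`. The copy takes its first `t` vertices, and `inject≤` keeps the
  -- positions on which `StarEdge` depends.
  star-copy : ∀ {c v L t r} → Unique (v ∷ L) → All (λ x → colour v x ≡ c) L → Matched c r L →
    t ≤ suc (length L) → HasMonochromaticCopy χ (S t r)
  star-copy {c} {v} {L} {t} {r} u v~ M t≤ =
    mk↣ (λ {i} {j} eq → inject≤-injective t≤ t≤ i j (List-lookup-injective u _ _ eq)) , c , edge
    where
    f : Fin t → Fin n
    f i = List.lookup (v ∷ L) (inject≤ i t≤)

    forward : ∀ i j → StarEdge t r i j → colour (f i) (f j) ≡ c
    forward i j e = star-edge v~ M (inject≤ i t≤) (inject≤ j t≤) e′
      where
      e′ : (toℕ (inject≤ i t≤) ≡ 0 × 0 < toℕ (inject≤ j t≤)) ⊎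
           (∃ λ (m : Fin r) → toℕ (inject≤ i t≤) ≡ 1 + 2 * toℕ m × toℕ (inject≤ j t≤) ≡ 2 + 2 * toℕ m)
      e′ rewrite toℕ-inject≤ i t≤ | toℕ-inject≤ j t≤ = e

    edge : ∀ i j → Graph.Adj (S t r) i j → colour (f i) (f j) ≡ c
    edge i j (inj₁ e) = forward i j e
    edge i j (inj₂ e) = trans (colour-sym (f i) (f j)) (forward j i e)

  clique-matched : ∀ {c} r L → AllPairs (λ x y → colour x y ≡ c) L → 2 * r ≤ length L → Matched c r L
  clique-matched zero    L _ _ = done
  clique-matched (suc r) L K r≤ rewrite *-suc 2 r with L | K | r≤
  ... | x ∷ y ∷ L′ | (xy ∷ _) ∷ _ ∷ K′ | s≤s (s≤s r≤′) = pair xy (clique-matched r L′ K′ r≤′)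

  clique-copy : ∀ {c L t r} → Unique L → AllPairs (λ x y → colour x y ≡ c) L →
    t ≤ length L → suc (2 * r) ≤ t → HasMonochromaticCopy χ (S t r)
  clique-copy {L = []}    {r = r} _ _ z≤n ()
  clique-copy {L = v ∷ L} {r = r} u (v~ ∷ K) t≤ 2r<t =
    star-copy u v~ (clique-matched r L K (≤-pred (≤-trans 2r<t t≤))) t≤

  -- The entries of `L` behind the `r` given pairs can be alternated with those of `B` to get `j`
  -- more pairs, because every edge between `L` and `B` has colour `c`. The bound `2 * r + j` counts
  -- the entries of `L` used up.
  weave : ∀ {c r} j L B → Matched c r L → All (λ x → All (λ y → colour x y ≡ c) B) L →
    2 * r + j ≤ length L → j ≤ length B → ∃ λ L′ → L′ ↭ L ++ B × Matched c (r + j) L′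
  weave {r = suc r} j (x ∷ y ∷ L) B (pair e M) (_ ∷ _ ∷ X) j≤ j≤B
    with weave j L B M X (≤-pred (≤-pred (subst (λ m → m + j ≤ 2 + length L) (*-suc 2 r) j≤))) j≤B
  ... | L′ , p , M′ = x ∷ y ∷ L′ , prep x (prep y p) , pair e M′
  weave zero L B done X _ _ = L ++ B , ↭-refl , done
  weave (suc j) (x ∷ L) (y ∷ B) done ((xy ∷ _) ∷ X) (s≤s j≤) (s≤s j≤B)
    with weave j L B done (All.map All.tail X) j≤ j≤B
  ... | L′ , p , M′ =
    x ∷ y ∷ L′ , prep x (↭-trans (prep y p) (↭-sym (shift y L B))) , pair xy M′

  extract : ∀ c L → AllPairs (λ x y → colour x y ≢ c) L ⊎
    (∃₂ λ x y → ∃ λ L′ → colour x y ≡ c × x ∷ y ∷ L′ ↭ L)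
  extract c [] = inj₁ []
  extract c (x ∷ L) with partner L
    where
    partner : ∀ M → All (λ y → colour x y ≢ c) M ⊎
      (∃₂ λ y M′ → colour x y ≡ c × y ∷ M′ ↭ M)
    partner [] = inj₁ []
    partner (y ∷ M) with colour x y Fin.≟ c | partner M
    ... | yes e | _ = inj₂ (y , M , e , ↭-refl)
    ... | no ¬e | inj₁ a = inj₁ (¬e ∷ a)
    ... | no ¬e | inj₂ (z , M′ , e , p) =
      inj₂ (z , y ∷ M′ , e , ↭-trans (swap z y ↭-refl) (prep y p))
  ... | inj₂ (y , L′ , e , p) = inj₂ (x , y , L′ , e , prep x p)
  ... | inj₁ a with extract c L
  ... | inj₁ K = inj₁ (a ∷ K)
  ... | inj₂ (y , z , L′ , e , p) =
    inj₂ (y , z , x ∷ L′ , e ,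
          ↭-trans (prep y (swap z x ↭-refl)) (↭-trans (swap y x ↭-refl) (prep x p)))

  -- Edges of colour `c` are removed one by one. If this stops before `r` edges, at most
  -- `2 * (r - 1)` vertices are gone and `R` has no such edge left; the final inequality is this
  -- count without subtraction.
  greedy : ∀ c r L → (∃ λ L′ → L′ ↭ L × Matched c r L′) ⊎
    (∃₂ λ R M → M ++ R ↭ L × AllPairs (λ x y → colour x y ≢ c) R × 2 + length L ≤ length R + 2 * r)
  greedy c zero    L = inj₁ (L , ↭-refl , done)
  greedy c (suc r) L with extract c L
  ... | inj₁ K = inj₂ (L , [] , ↭-refl , K ,
    ≤-trans (≤-reflexive (+-comm 2 (length L)))
            (+-monoʳ-≤ (length L) (*-monoʳ-≤ 2 (s≤s z≤n))))
  ... | inj₂ (x , y , L′ , e , p) with greedy c r L′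
  ... | inj₁ (L″ , q , M) = inj₁ (x ∷ y ∷ L″ , ↭-trans (prep x (prep y q)) p , pair e M)
  ... | inj₂ (R , M , q , K , ≤R) =
    inj₂ (R , x ∷ y ∷ M , ↭-trans (prep x (prep y q)) p , K , size)
    where
    open ≤-Reasoning
    size : 2 + length L ≤ length R + 2 * suc r
    size = begin
      2 + length L               ≡⟨ cong (2 +_) (↭-length p) ⟨
      2 + (2 + length L′)        ≤⟨ +-monoʳ-≤ 2 ≤R ⟩
      2 + (length R + 2 * r)     ≡⟨ +-assoc 2 (length R) (2 * r) ⟨
      (2 + length R) + 2 * r     ≡⟨ cong (_+ 2 * r) (+-comm 2 (length R)) ⟩
      (length R + 2) + 2 * r     ≡⟨ +-assoc (length R) 2 (2 * r) ⟩
      length R + (2 + 2 * r)     ≡⟨ cong (length R +_) (*-suc 2 r) ⟨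
      length R + 2 * suc r       ∎

  -- Here `c` is the dominant colour and `d` the other colour inside `A`. If `r` exceeds `length B`,
  -- the matching takes `k = r - length B` edges inside `A`, and `weave` adds one for each vertex of
  -- `B`. If the greedy choice inside `A` stops before `k`, what remains of `A` is a clique of
  -- colour `d`.
  dominated-copy : ∀ {c d v t r} A B → Unique (v ∷ A ++ B) → All (λ x → colour v x ≡ c) (A ++ B) →
    All (λ x → All (λ y → colour x y ≡ c) B) A →
    AllPairs (λ x y → colour x y ≢ c → colour x y ≡ d) A →
    length B ≤ length A → t ≤ suc (length A + length B) → suc (2 * r) ≤ t →
    t + 2 * r ≤ 2 + length A + 2 * length B → HasMonochromaticCopy χ (S t r)
  dominated-copy {c} {d} {v} {t} {r} A B u v~ X W b≤a t≤ 2r<t tr≤ = by-size (≤-total r b)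
    where
    open ≤-Reasoning
    a b : ℕ
    a = length A
    b = length B

    from-matching : ∀ {L} → L ↭ A ++ B → Matched c r L → HasMonochromaticCopy χ (S t r)
    from-matching {L} p M = star-copy (Unique-resp-↭ (prep v (↭-sym p)) u) (All-resp-↭ (↭-sym p) v~) M
      (subst (λ m → t ≤ suc m) (trans (sym (length-++ A)) (sym (↭-length p))) t≤)

    W-sym : Symmetric (λ x y → colour x y ≢ c → colour x y ≡ d)
    W-sym {x} {y} w rewrite colour-sym x y = w

    by-size : r ≤ b ⊎ b ≤ r → HasMonochromaticCopy χ (S t r)
    by-size (inj₁ r≤b) with weave r A B done X (≤-trans r≤b b≤a) r≤b
    ... | _ , p , M = from-matching p M
    by-size (inj₂ b≤r) with m≤n⇒∃[o]m+o≡n b≤r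
    ... | k , b+k≡r with greedy c k A
    ... | inj₁ (L , p , M)
      with weave b L B M (All-resp-↭ (↭-sym p) X) (subst (2 * k + b ≤_) (sym (↭-length p)) room) ≤-refl
      where
      -- Besides the `k` pairs, `A` must hold a partner for each vertex of `B`. As `r = b + k`, this
      -- is `2 * r ≤ a + b` with one `b` cancelled.
      room : 2 * k + b ≤ a
      room = +-cancelʳ-≤ b (2 * k + b) a (≤-pred (begin
        suc ((2 * k + b) + b)  ≡⟨ cong suc (trans (+-assoc (2 * k) b b) (+-comm (2 * k) (b + b))) ⟩
        suc (b + b + 2 * k)    ≡⟨ cong (λ m → suc (b + m + 2 * k)) (+-identityʳ b) ⟨
        suc (2 * b + 2 * k)    ≡⟨ cong suc (*-distribˡ-+ 2 b k) ⟨
        suc (2 * (b + k))      ≡⟨ cong (λ m → suc (2 * m)) b+k≡r ⟩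
        suc (2 * r)            ≤⟨ ≤-trans 2r<t t≤ ⟩
        suc (a + b)            ∎))
    ... | _ , q , M′ =
      from-matching (↭-trans q (++⁺ʳ B p)) (subst (λ m → Matched c m _) (trans (+-comm k b) b+k≡r) M′)
    by-size (inj₂ b≤r) | k , b+k≡r | inj₂ (R , M , p , K , a≤) =
      clique-copy (AllPairs-++⁻ʳ M (Unique-resp-↭ (↭-sym p) (AllPairs-++⁻ˡ A (AllPairs.tail u))))
                  (AllPairs.zipWith (λ (⇒d , ≢c) → ⇒d ≢c)
                    (AllPairs-++⁻ʳ M (AllPairs-resp-↭ W-sym (↭-sym p) W) , K))
                  t≤R 2r<t
      where
      -- At most `2 * (k - 1)` vertices of `A` are lost, and by `tr≤` the remaining `a + 2 - 2 * k`
      -- are at least `t`.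
      t≤R : t ≤ length R
      t≤R = +-cancelʳ-≤ (2 * r) t (length R) (begin
        t + 2 * r                    ≤⟨ tr≤ ⟩
        (2 + a) + 2 * b              ≤⟨ +-monoˡ-≤ (2 * b) a≤ ⟩
        (length R + 2 * k) + 2 * b   ≡⟨ +-assoc (length R) (2 * k) (2 * b) ⟩
        length R + (2 * k + 2 * b)   ≡⟨ cong (length R +_) (*-distribˡ-+ 2 k b) ⟨
        length R + 2 * (k + b)       ≡⟨ cong (λ m → length R + 2 * m) (trans (+-comm k b) b+k≡r) ⟩
        length R + 2 * r             ∎)

-- Distinctness and surjectivity on finite sets

unique? : ∀ {A : Set} → DecidableEquality A → ∀ {n} → Decidable (Uniqueᵛ {A = A} {n})
unique? _≟_ = allPairs? (λ x y → ¬? (x ≟ y))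

distinct : ∀ {n k} {xs : Vec (Fin n) k} {u : True (unique? Fin._≟_ xs)} → Uniqueᵛ xs
distinct {u = u} = toWitness u

-- A missed value `y` could be punched out of the codomain, leaving an injection into a smaller set.
-- For a list of four distinct colours this says that every colour occurs in it.
injective⇒surjective : ∀ {n} {f : Fin n → Fin n} → Injective _≡_ _≡_ f → ∀ y → ∃ λ x → f x ≡ y
injective⇒surjective {n} {f} inj y with any? (λ x → f x Fin.≟ y)
... | yes x = x
injective⇒surjective {suc n} {f} inj y | no ∄x =
  ⊥-elim (1+n≰n (injective⇒≤ {f = λ x → punchOut (y≢ x)} (λ {a} {b} eq →
    inj (punchOut-injective (y≢ a) (y≢ b) eq))))
  where
  y≢ : ∀ x → y ≢ f x
  y≢ x eq = ∄x (x , sym eq)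

-- Small configurations

Edge : ℕ → Set
Edge m = Fin m × Fin m

pathEdges : ∀ {A : Set} → Vec A 5 → Vec (A × A) 4
pathEdges (a ∷ b ∷ c ∷ d ∷ e ∷ []) = (a , b) ∷ (b , c) ∷ (c , d) ∷ (d , e) ∷ []

-- A triangle with one pendant edge at its first vertex.
pawEdges : ∀ {A : Set} → Vec A 4 → Vec (A × A) 4
pawEdges (p ∷ q ∷ s ∷ z ∷ []) = (p , q) ∷ (p , s) ∷ (q , s) ∷ (p , z) ∷ []

-- Backtracking over the colours of the edges of K_m, where colour i stands for π i. The search
-- succeeds if every colouring that extends K makes one of the 4-edge patterns ps rainbow.
module Search {m : ℕ} (g : Edge m → Fin 4) (g-sym : ∀ i j → g (i , j) ≡ g (j , i))
              (π : Fin 4 → Fin 4) (π-injective : Injective _≡_ _≡_ π) where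

  Knowledge : Set
  Knowledge = List (Edge m × Fin 4)

  Agrees : Knowledge → Set
  Agrees = All (λ (e , i) → g e ≡ π i)

  RainbowPattern : Vec (Edge m) 4 → Set
  RainbowPattern es = Uniqueᵛ (Vec.map g es)

  known : ∀ K e → Maybe (∃ λ i → Agrees K → g e ≡ π i)
  known [] e = nothing
  known (((a , b) , i) ∷ K) (a′ , b′) with ≡-dec Fin._≟_ Fin._≟_ (a , b) (a′ , b′)
  ... | yes refl = just (i , All.head)
  ... | no _ with ≡-dec Fin._≟_ Fin._≟_ (b , a) (a′ , b′)
  ... | yes refl = just (i , λ ag → trans (g-sym b a) (All.head ag))
  ... | no _ = map (λ (j , p) → j , p ∘ All.tail) (known K (a′ , b′))

  knowns : ∀ K {k} (es : Vec (Edge m) k) → Maybe (∃ λ is → Agrees K → Vec.map g es ≡ Vec.map π is)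
  knowns K [] = just ([] , λ _ → refl)
  knowns K (e ∷ es) with known K e | knowns K es
  ... | just (i , p) | just (is , ps) = just (i ∷ is , λ ag → cong₂ _∷_ (p ag) (ps ag))
  ... | just _       | nothing        = nothing
  ... | nothing      | _              = nothing

  -- Distinct indices mean distinct colours because `π` is injective, so one search on indices
  -- serves every assignment of the four colours.
  rainbow? : ∀ K es → Maybe (Agrees K → RainbowPattern es)
  rainbow? K es with knowns K es
  ... | nothing = nothing
  ... | just (is , p) with unique? Fin._≟_ is
  ... | no _  = nothing
  ... | yes u = just (λ ag → subst Uniqueᵛ (sym (p ag)) (map⁺ π-injective u))

  anyRainbow? : ∀ K ps → Maybe (Agrees K → Any RainbowPattern ps)
  anyRainbow? K []        = nothing
  anyRainbow? K (es ∷ ps) with rainbow? K es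
  ... | just r  = just (here ∘ r)
  ... | nothing = map (there ∘_) (anyRainbow? K ps)

  search : ∀ ps K → List (Edge m) → Maybe (Agrees K → Any RainbowPattern ps)
  search ps K todo with anyRainbow? K ps
  search ps K todo       | just r  = just r
  search ps K []         | nothing = nothing
  search ps K (e ∷ todo) | nothing =
    -- All four indices for `e` have to succeed; they are exhaustive, since `π` is also surjective.
    map split (Fin.sequence Maybe.applicative (λ i → search ps ((e , i) ∷ K) todo))
    where
    split : (∀ i → Agrees ((e , i) ∷ K) → Any RainbowPattern ps) → Agrees K → Any RainbowPattern ps
    split f ag with injective⇒surjective π-injective (g e)
    ... | i , πi≡ = f i (sym πi≡ ∷ ag)

  searchDistinct : ∀ ps K (e e′ : Edge m) → List (Edge m) →
    Maybe (∀ i j → i ≢ j → Agrees ((e , i) ∷ (e′ , j) ∷ K) → Any RainbowPattern ps)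
  searchDistinct ps K e e′ todo =
    Fin.sequence Maybe.applicative (λ i → Fin.sequence Maybe.applicative (λ j → entry i j))
    where
    entry : ∀ i j → Maybe (i ≢ j → Agrees ((e , i) ∷ (e′ , j) ∷ K) → Any RainbowPattern ps)
    entry i j with i Fin.≟ j
    ... | yes i≡j = just (λ i≢j → ⊥-elim (i≢j i≡j))
    ... | no  _   = map (λ r _ → r) (search ps ((e , i) ∷ (e′ , j) ∷ K) todo)

module Rainbow {n : ℕ} (χ : EdgeColoring 4 n) where
  open EdgeColoring χ

  hue : Edge n → Fin 4
  hue (x , y) = colour x y

  rainbow-path : ∀ w → Uniqueᵛ w → Uniqueᵛ (Vec.map hue (pathEdges w)) → HasRainbowCopy χ P₅
  rainbow-path w u uc = mk↣ (λ {i} {j} → lookup-injective u i j) , rainbow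
    where
    step : Fin 4 → Fin 4
    step e = colour (lookup w (inject₁ e)) (lookup w (suc e))

    step-injective : ∀ {d e} → step d ≡ step e → d ≡ e
    step-injective {d} {e} eq = lookup-injective uc d e (trans (step≡ w d) (trans eq (sym (step≡ w e))))
      where
      step≡ : ∀ w d → lookup (Vec.map hue (pathEdges w)) d ≡ colour (lookup w (inject₁ d)) (lookup w (suc d))
      step≡ (a ∷ b ∷ c ∷ d ∷ e ∷ []) zero                   = refl
      step≡ (a ∷ b ∷ c ∷ d ∷ e ∷ []) (suc zero)             = refl
      step≡ (a ∷ b ∷ c ∷ d ∷ e ∷ []) (suc (suc zero))       = refl
      step≡ (a ∷ b ∷ c ∷ d ∷ e ∷ []) (suc (suc (suc zero))) = refl

    forward : ∀ {a b : Fin 5} → toℕ b ≡ suc (toℕ a) → ∃ λ e → a ≡ inject₁ e × b ≡ suc e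
    forward {a} {suc e} eq = e , toℕ-injective (trans (sym (suc-injective eq)) (sym (toℕ-inject₁ e))) , refl

    edge : ∀ {a b} → Graph.Adj P₅ a b → ∃ λ e →
      ((a ≡ inject₁ e × b ≡ suc e) ⊎ (a ≡ suc e × b ≡ inject₁ e)) ×
      colour (lookup w a) (lookup w b) ≡ step e
    edge (inj₁ eq) with forward eq
    ... | e , refl , refl = e , inj₁ (refl , refl) , refl
    edge (inj₂ eq) with forward eq
    ... | e , refl , refl = e , inj₂ (refl , refl) , colour-sym _ _

    rainbow : ∀ a b a′ b′ → Graph.Adj P₅ a b → Graph.Adj P₅ a′ b′ →
      colour (lookup w a) (lookup w b) ≡ colour (lookup w a′) (lookup w b′) →
      (a ≡ a′ × b ≡ b′) ⊎ (a ≡ b′ × b ≡ a′)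
    rainbow a b a′ b′ ab ab′ eq with edge ab | edge ab′
    ... | e , o , p | e′ , o′ , p′ with step-injective {e} {e′} (trans (sym p) (trans eq p′))
    rainbow a b a′ b′ ab ab′ eq | e , inj₁ (refl , refl) , p | e , inj₁ (refl , refl) , p′ | refl = inj₁ (refl , refl)
    rainbow a b a′ b′ ab ab′ eq | e , inj₁ (refl , refl) , p | e , inj₂ (refl , refl) , p′ | refl = inj₂ (refl , refl)
    rainbow a b a′ b′ ab ab′ eq | e , inj₂ (refl , refl) , p | e , inj₁ (refl , refl) , p′ | refl = inj₂ (refl , refl)
    rainbow a b a′ b′ ab ab′ eq | e , inj₂ (refl , refl) , p | e , inj₂ (refl , refl) , p′ | refl = inj₁ (refl , refl)

  RainbowPaw : Set
  RainbowPaw = ∃ λ (w : Vec (Fin n) 4) → Uniqueᵛ w × Uniqueᵛ (Vec.map hue (pawEdges w))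

  -- Pulls the colouring back to `K_m`, whose vertices are concrete, so that the search can be
  -- evaluated there; `embed` carries distinctness back.
  module Restrict {m : ℕ} (vs : Vec (Fin n) m) (vs-unique : Uniqueᵛ vs) where
    g : Edge m → Fin 4
    g (i , j) = colour (lookup vs i) (lookup vs j)

    g-sym : ∀ i j → g (i , j) ≡ g (j , i)
    g-sym i j = colour-sym _ _

    embed : ∀ {k} {w : Vec (Fin m) k} → Uniqueᵛ w → Uniqueᵛ (Vec.map (lookup vs) w)
    embed = map⁺ (λ {i} {j} → lookup-injective vs-unique i j)

    find-path : (ps : List (Vec (Fin m) 5)) → All Uniqueᵛ ps →
      Any (λ es → Uniqueᵛ (Vec.map g es)) (List.map pathEdges ps) → HasRainbowCopy χ P₅
    find-path ps us r with All.lookupAny us (Any.map⁻ r)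
    ... | u , uc with Any.lookup (Any.map⁻ r)
    ... | a ∷ b ∷ c ∷ d ∷ e ∷ [] = rainbow-path _ (embed u) uc

    find-paw : (ps : List (Vec (Fin m) 4)) → All Uniqueᵛ ps →
      Any (λ es → Uniqueᵛ (Vec.map g es)) (List.map pawEdges ps) → RainbowPaw
    find-paw ps us r with All.lookupAny us (Any.map⁻ r)
    ... | u , uc with Any.lookup (Any.map⁻ r)
    ... | p ∷ q ∷ s ∷ z ∷ [] = _ , embed u , uc

  -- Below, vertex i of K_m is the i-th entry of the vertex list in the lemma that follows. The
  -- patterns and the few edges to branch on come from a computer search for a small refutation.

  spiderPaths : List (Vec (Fin 5) 5)
  spiderPaths = (3F ∷ 0F ∷ 1F ∷ 2F ∷ 4F ∷ []) ∷ (1F ∷ 4F ∷ 2F ∷ 0F ∷ 3F ∷ []) ∷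
                (2F ∷ 4F ∷ 1F ∷ 0F ∷ 3F ∷ []) ∷ (3F ∷ 0F ∷ 2F ∷ 1F ∷ 4F ∷ []) ∷ []

  spiderPaws : List (Vec (Fin 5) 4)
  spiderPaws = (0F ∷ 1F ∷ 2F ∷ 3F ∷ []) ∷ (1F ∷ 2F ∷ 4F ∷ 0F ∷ []) ∷
               (1F ∷ 0F ∷ 2F ∷ 4F ∷ []) ∷ []

  -- If `ab` has any colour but that of `vb`, it completes a rainbow path or paw at once. If it has
  -- that colour, each of the four colours of `by` completes one.
  spider⇒paw : ∀ {v a b c y} → Uniqueᵛ (v ∷ a ∷ b ∷ c ∷ y ∷ []) →
    Uniqueᵛ (colour v a ∷ colour v b ∷ colour v c ∷ colour a y ∷ []) →
    HasRainbowCopy χ P₅ ⊎ RainbowPaw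
  spider⇒paw {v} {a} {b} {c} {y} u uc =
    [ inj₁ ∘ find-path spiderPaths (from-yes (All.all? (unique? Fin._≟_) spiderPaths))
    , inj₂ ∘ find-paw  spiderPaws  (from-yes (All.all? (unique? Fin._≟_) spiderPaws)) ]′
    (Any.++⁻ (List.map pathEdges spiderPaths)
      (from-just (search (List.map pathEdges spiderPaths ++ List.map pawEdges spiderPaws)
                         (((0F , 1F) , 0F) ∷ ((0F , 2F) , 1F) ∷ ((0F , 3F) , 2F) ∷ ((1F , 4F) , 3F) ∷ [])
                         ((1F , 2F) ∷ (2F , 4F) ∷ []))
                 (refl ∷ refl ∷ refl ∷ refl ∷ [])))
    where
    open Restrict _ u
    open Search g g-sym (lookup (colour v a ∷ colour v b ∷ colour v c ∷ colour a y ∷ []))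
                (λ {i} {j} → lookup-injective uc i j)

  starPaths : List (Vec (Fin 5) 5)
  starPaths = (1F ∷ 2F ∷ 0F ∷ 4F ∷ 3F ∷ []) ∷ (1F ∷ 2F ∷ 0F ∷ 3F ∷ 4F ∷ []) ∷
              (2F ∷ 1F ∷ 0F ∷ 3F ∷ 4F ∷ []) ∷ (2F ∷ 1F ∷ 0F ∷ 4F ∷ 3F ∷ []) ∷ []

  starPaws : List (Vec (Fin 5) 4)
  starPaws = (0F ∷ 3F ∷ 4F ∷ 2F ∷ []) ∷ (0F ∷ 1F ∷ 2F ∷ 4F ∷ []) ∷
             (0F ∷ 3F ∷ 4F ∷ 1F ∷ []) ∷ (0F ∷ 1F ∷ 2F ∷ 3F ∷ []) ∷ []

  -- If `ab` has the colour of `vc` or `vd`, the triangle `vab` is rainbow and the other of these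
  -- two edges is its pendant edge; `cd` is symmetric. Otherwise `ab` repeats `va` or `vb`, `cd`
  -- repeats `vc` or `vd`, and a path through `v` with `ab` and `cd` at its ends is rainbow.
  star⇒paw : ∀ {v a b c d} → Uniqueᵛ (v ∷ a ∷ b ∷ c ∷ d ∷ []) →
    Uniqueᵛ (colour v a ∷ colour v b ∷ colour v c ∷ colour v d ∷ []) →
    HasRainbowCopy χ P₅ ⊎ RainbowPaw
  star⇒paw {v} {a} {b} {c} {d} u uc =
    [ inj₁ ∘ find-path starPaths (from-yes (All.all? (unique? Fin._≟_) starPaths))
    , inj₂ ∘ find-paw  starPaws  (from-yes (All.all? (unique? Fin._≟_) starPaws)) ]′
    (Any.++⁻ (List.map pathEdges starPaths)
      (from-just (search (List.map pathEdges starPaths ++ List.map pawEdges starPaws)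
                         (((0F , 1F) , 0F) ∷ ((0F , 2F) , 1F) ∷ ((0F , 3F) , 2F) ∷ ((0F , 4F) , 3F) ∷ [])
                         ((1F , 2F) ∷ (3F , 4F) ∷ []))
                 (refl ∷ refl ∷ refl ∷ refl ∷ [])))
    where
    open Restrict _ u
    open Search g g-sym (lookup (colour v a ∷ colour v b ∷ colour v c ∷ colour v d ∷ []))
                (λ {i} {j} → lookup-injective uc i j)

  pawPaths : List (Vec (Fin 6) 5)
  pawPaths =
    (2F ∷ 5F ∷ 1F ∷ 0F ∷ 4F ∷ []) ∷ (2F ∷ 4F ∷ 3F ∷ 0F ∷ 5F ∷ []) ∷
    (2F ∷ 4F ∷ 0F ∷ 1F ∷ 5F ∷ []) ∷ (4F ∷ 3F ∷ 0F ∷ 1F ∷ 5F ∷ []) ∷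
    (4F ∷ 3F ∷ 2F ∷ 5F ∷ 1F ∷ []) ∷ (4F ∷ 2F ∷ 3F ∷ 0F ∷ 5F ∷ []) ∷
    (2F ∷ 3F ∷ 4F ∷ 0F ∷ 5F ∷ []) ∷ (3F ∷ 0F ∷ 5F ∷ 2F ∷ 4F ∷ []) ∷
    (3F ∷ 2F ∷ 5F ∷ 0F ∷ 4F ∷ []) ∷ (4F ∷ 2F ∷ 5F ∷ 1F ∷ 0F ∷ []) ∷
    (3F ∷ 0F ∷ 4F ∷ 2F ∷ 5F ∷ []) ∷ (3F ∷ 4F ∷ 2F ∷ 5F ∷ 1F ∷ []) ∷
    (2F ∷ 3F ∷ 4F ∷ 0F ∷ 1F ∷ []) ∷ (4F ∷ 2F ∷ 3F ∷ 0F ∷ 1F ∷ []) ∷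
    (3F ∷ 2F ∷ 4F ∷ 0F ∷ 5F ∷ []) ∷ (3F ∷ 4F ∷ 0F ∷ 1F ∷ 5F ∷ []) ∷
    (2F ∷ 4F ∷ 3F ∷ 0F ∷ 1F ∷ []) ∷ (2F ∷ 3F ∷ 0F ∷ 5F ∷ 1F ∷ []) ∷
    (2F ∷ 5F ∷ 0F ∷ 3F ∷ 4F ∷ []) ∷ (5F ∷ 2F ∷ 3F ∷ 0F ∷ 1F ∷ []) ∷
    (4F ∷ 0F ∷ 3F ∷ 2F ∷ 5F ∷ []) ∷ (2F ∷ 5F ∷ 0F ∷ 4F ∷ 3F ∷ []) ∷
    (5F ∷ 2F ∷ 4F ∷ 3F ∷ 0F ∷ []) ∷ []

  -- The local form of the claim that all edges off the triangle have one colour. If `zx` and `xy`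
  -- differ, branching further on `qx`, `sx` and `zy` always meets a rainbow path.
  paw⇒equal-colours : ∀ {p q s z x y} → Uniqueᵛ (x ∷ y ∷ p ∷ q ∷ s ∷ z ∷ []) →
    Uniqueᵛ (colour p q ∷ colour p s ∷ colour q s ∷ colour p z ∷ []) →
    HasRainbowCopy χ P₅ ⊎ colour z x ≡ colour x y
  paw⇒equal-colours {p} {q} {s} {z} {x} {y} u uc with colour z x Fin.≟ colour x y
  ... | yes eq  = inj₂ eq
  ... | no  neq with injective⇒surjective (λ {i} {j} → lookup-injective uc i j) (colour z x)
                   | injective⇒surjective (λ {i} {j} → lookup-injective uc i j) (colour x y)
  ... | i , πi≡ | j , πj≡ =
    inj₁ (find-path pawPaths (from-yes (All.all? (unique? Fin._≟_) pawPaths))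
      (from-just (searchDistinct (List.map pathEdges pawPaths)
                   (((2F , 3F) , 0F) ∷ ((2F , 4F) , 1F) ∷ ((3F , 4F) , 2F) ∷ ((2F , 5F) , 3F) ∷ [])
                   (5F , 0F) (0F , 1F) ((3F , 0F) ∷ (4F , 0F) ∷ (5F , 1F) ∷ []))
        i j (λ { refl → neq (trans (sym πi≡) πj≡) })
        (sym πi≡ ∷ sym πj≡ ∷ refl ∷ refl ∷ refl ∷ refl ∷ [])))
    where
    open Restrict _ u
    open Search g g-sym (lookup (colour p q ∷ colour p s ∷ colour q s ∷ colour p z ∷ []))
                (λ {i} {j} → lookup-injective uc i j)

-- Vertices outside a small configuration

without : ∀ {n k} → Vec (Fin n) k → List (Fin n)
without {n} []       = allFin n
without     (w ∷ ws) = filter (λ x → ¬? (x Fin.≟ w)) (without ws)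

without-unique : ∀ {n k} (ws : Vec (Fin n) k) → Unique (without ws)
without-unique []       = Unique.allFin⁺ _
without-unique (w ∷ ws) = Unique.filter⁺ _ (without-unique ws)

without-avoids : ∀ {n k} (ws : Vec (Fin n) k) → All (λ x → Allᵛ (x ≢_) ws) (without ws)
without-avoids []       = All.universal (λ _ → []) _
without-avoids (w ∷ ws) =
  All.zipWith (λ (p , q) → p ∷ q) (All.all-filter _ (without ws) , All.filter⁺ _ (without-avoids ws))

length-remove : ∀ {n} (w : Fin n) {xs} → Unique xs →
  length xs ≤ suc (length (filter (λ x → ¬? (x Fin.≟ w)) xs))
length-remove w [] = z≤n
length-remove w {x ∷ xs} (x∉ ∷ u) with x Fin.≟ w
... | no _     = s≤s (length-remove w u)
... | yes refl = s≤s (≤-reflexive (cong length (sym (filter-all _ (All.map ≢-sym x∉)))))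

length-without : ∀ {n k} (ws : Vec (Fin n) k) → n ≤ k + length (without ws)
length-without []       = ≤-reflexive (sym (length-tabulate _))
length-without {k = suc k} (w ∷ ws) = ≤-trans (length-without ws)
  (≤-trans (+-monoʳ-≤ k (length-remove w (without-unique ws))) (≤-reflexive (+-suc k _)))

unique₄ : ∀ {A : Set} {a b c d α β γ δ : A} → a ≡ α → b ≡ β → c ≡ γ → d ≡ δ →
  Uniqueᵛ (α ∷ β ∷ γ ∷ δ ∷ []) → Uniqueᵛ (a ∷ b ∷ c ∷ d ∷ [])
unique₄ refl refl refl refl u = u

-- Rainbow paws and cherries

module Structure {n : ℕ} (χ : EdgeColoring 4 n) where
  open EdgeColoring χ
  open Stars χ
  open Rainbow χ

  -- Without a rainbow path, `zx` and `zy` both share the colour of `xy` for all `x`, `y` off the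
  -- paw. Hence `z` and the vertices off the paw form a monochromatic clique, on at least `n - 3`
  -- vertices.
  paw⇒copy : ∀ {t r} → RainbowPaw → t + 3 ≤ n → suc (2 * r) ≤ t →
    HasRainbowCopy χ P₅ ⊎ HasMonochromaticCopy χ (S t r)
  paw⇒copy {t} {r} (w@(p ∷ q ∷ s ∷ z ∷ []) , u , uc) t+3≤n 2r<t
    with any? (λ x → any? (λ y → unique? Fin._≟_ (x ∷ y ∷ w) ×-dec ¬? (colour z x Fin.≟ colour x y)))
  ... | yes (x , y , uxy , neq) = [ inj₁ , (λ eq → ⊥-elim (neq eq)) ]′ (paw⇒equal-colours uxy uc)
  ... | no ∄xy = inj₂ (clique-copy (z∉ ∷ without-unique w) clique t≤ 2r<t)
    where
    L : List (Fin n)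
    L = without w

    z∉ : All (z ≢_) L
    z∉ = All.map (λ { (_ ∷ _ ∷ _ ∷ x≢z ∷ []) → ≢-sym x≢z }) (without-avoids w)

    t≤ : t ≤ suc (length L)
    t≤ = +-cancelˡ-≤ 3 t (suc (length L)) (≤-trans (≤-reflexive (+-comm 3 t))
      (≤-trans t+3≤n (≤-trans (length-without w) (≤-reflexive (sym (+-suc 3 (length L)))))))

    equal-colours : ∀ {x y} → x ≢ y → Allᵛ (x ≢_) w → Allᵛ (y ≢_) w → colour z x ≡ colour x y
    equal-colours {x} {y} x≢y x∉ y∉ = decidable-stable (colour z x Fin.≟ colour x y)
      (λ neq → ∄xy (x , y , (x≢y ∷ x∉) ∷ y∉ ∷ u , neq))

    equal-spokes : ∀ {x y} → x ≢ y → Allᵛ (x ≢_) w → Allᵛ (y ≢_) w → colour z x ≡ colour z y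
    equal-spokes {x} {y} x≢y x∉ y∉ = trans (equal-colours x≢y x∉ y∉)
      (trans (colour-sym x y) (sym (equal-colours (≢-sym x≢y) y∉ x∉)))

    pairs : ∀ {c M} → All (λ x → colour z x ≡ c) M → All (λ x → Allᵛ (x ≢_) w) M → Unique M →
      AllPairs (λ x y → colour x y ≡ c) M
    pairs []       _         _        = []
    pairs (e ∷ es) (x∉ ∷ ∉s) (x≢ ∷ u) =
      All.zipWith (λ (x≢y , y∉) → trans (sym (equal-colours x≢y x∉ y∉)) e) (x≢ , ∉s) ∷ pairs es ∉s u

    spokes : ∀ {M} → All (λ x → Allᵛ (x ≢_) w) M → Unique M → ∃ λ c → All (λ x → colour z x ≡ c) M
    -- With no vertex off the paw the colour is arbitrary.
    spokes []        _        = 0F , []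
    spokes (x∉ ∷ ∉s) (x≢ ∷ _) =
      _ , refl ∷ All.zipWith (λ (x≢y , y∉) → sym (equal-spokes x≢y x∉ y∉)) (x≢ , ∉s)

    c : Fin 4
    c = proj₁ (spokes (without-avoids w) (without-unique w))

    clique : AllPairs (λ x y → colour x y ≡ c) (z ∷ L)
    clique = proj₂ (spokes (without-avoids w) (without-unique w)) ∷
      pairs (proj₂ (spokes (without-avoids w) (without-unique w))) (without-avoids w) (without-unique w)

  Cherry : Fin 4 → Fin 4 → Set
  Cherry α β = ∃ λ v → ∃₂ λ x y → (v ≢ x × v ≢ y) × colour v x ≡ α × colour v y ≡ β

  Cherry? : ∀ α β → Dec (Cherry α β)
  Cherry? α β = any? λ v → any? λ x → any? λ y →
    (¬? (v Fin.≟ x) ×-dec ¬? (v Fin.≟ y)) ×-dec (colour v x Fin.≟ α) ×-dec (colour v y Fin.≟ β)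

  Cherry-sym : ∀ {α β} → Cherry α β → Cherry β α
  Cherry-sym (v , x , y , (v≢x , v≢y) , p , q) = v , y , x , (v≢y , v≢x) , q , p

  apart : ∀ {v x y α β} → colour v x ≡ α → colour v y ≡ β → α ≢ β → x ≢ y
  apart p q α≢β refl = α≢β (trans (sym p) q)

  -- The edge between the two centres belongs to the first cherry. If `y` is a leaf of the second
  -- cherry, a triangle on `v`, `v′`, `y` with a pendant edge at `v′` appears; if not, a spider with
  -- centre `v′` whose long leg runs through `v` to `y`.
  bridge⇒paw : ∀ {α β γ δ v v′ y x′ y′} → Uniqueᵛ (α ∷ β ∷ γ ∷ δ ∷ []) →
    v ≢ v′ → v ≢ y → v′ ≢ x′ → v′ ≢ y′ →
    colour v v′ ≡ α → colour v y ≡ β → colour v′ x′ ≡ γ → colour v′ y′ ≡ δ →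
    HasRainbowCopy χ P₅ ⊎ RainbowPaw
  bridge⇒paw {α} {β} {γ} {δ} {v} {v′} {y} {x′} {y′}
    ((α≢β ∷ α≢γ ∷ α≢δ ∷ []) ∷ (β≢γ ∷ β≢δ ∷ []) ∷ (γ≢δ ∷ []) ∷ _) v≢v′ v≢y v′≢x′ v′≢y′ vv′ vy v′x′ v′y′
    with y Fin.≟ x′ | y Fin.≟ y′
  ... | yes refl | _ = inj₂ (v′ ∷ v ∷ x′ ∷ y′ ∷ [] ,
    (≢-sym v≢v′ ∷ v′≢x′ ∷ v′≢y′ ∷ []) ∷ (v≢y ∷ apart v′v v′y′ α≢δ ∷ []) ∷
      (apart v′x′ v′y′ γ≢δ ∷ []) ∷ [] ∷ [] ,
    unique₄ v′v v′x′ vy v′y′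
      ((α≢γ ∷ α≢β ∷ α≢δ ∷ []) ∷ (≢-sym β≢γ ∷ γ≢δ ∷ []) ∷ (β≢δ ∷ []) ∷ [] ∷ []))
    where
    v′v : colour v′ v ≡ α
    v′v = trans (colour-sym v′ v) vv′
  ... | no _ | yes refl = inj₂ (v′ ∷ v ∷ y′ ∷ x′ ∷ [] ,
    (≢-sym v≢v′ ∷ v′≢y′ ∷ v′≢x′ ∷ []) ∷ (v≢y ∷ apart v′v v′x′ α≢γ ∷ []) ∷
      (≢-sym (apart v′x′ v′y′ γ≢δ) ∷ []) ∷ [] ∷ [] ,
    unique₄ v′v v′y′ vy v′x′
      ((α≢δ ∷ α≢β ∷ α≢γ ∷ []) ∷ (≢-sym β≢δ ∷ ≢-sym γ≢δ ∷ []) ∷ (β≢γ ∷ []) ∷ [] ∷ []))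
    where
    v′v : colour v′ v ≡ α
    v′v = trans (colour-sym v′ v) vv′
  ... | no y≢x′ | no y≢y′ = spider⇒paw
    ((≢-sym v≢v′ ∷ v′≢x′ ∷ v′≢y′ ∷ apart vv′ vy α≢β ∷ []) ∷
     (apart v′v v′x′ α≢γ ∷ apart v′v v′y′ α≢δ ∷ v≢y ∷ []) ∷
     (apart v′x′ v′y′ γ≢δ ∷ ≢-sym y≢x′ ∷ []) ∷ (≢-sym y≢y′ ∷ []) ∷ [] ∷ [])
    (unique₄ v′v v′x′ v′y′ vy
      ((α≢γ ∷ α≢δ ∷ α≢β ∷ []) ∷ (γ≢δ ∷ ≢-sym β≢γ ∷ []) ∷ (≢-sym β≢δ ∷ []) ∷ [] ∷ []))
    where
    v′v : colour v′ v ≡ α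
    v′v = trans (colour-sym v′ v) vv′

  -- A common centre gives a rainbow star. For different centres the edge `v v′` has one of the four
  -- colours and replaces the edge of that colour in its cherry, which is the case of `bridge⇒paw`
  -- up to a permutation of the roles.
  disjoint-cherries⇒paw : ∀ {α β γ δ} → Uniqueᵛ (α ∷ β ∷ γ ∷ δ ∷ []) → Cherry α β → Cherry γ δ →
    HasRainbowCopy χ P₅ ⊎ RainbowPaw
  disjoint-cherries⇒paw {α} {β} {γ} {δ}
    u@((α≢β ∷ α≢γ ∷ α≢δ ∷ []) ∷ (β≢γ ∷ β≢δ ∷ []) ∷ (γ≢δ ∷ []) ∷ _)
    (v , x , y , (v≢x , v≢y) , vx , vy) (v′ , x′ , y′ , (v′≢x′ , v′≢y′) , v′x′ , v′y′)
    with v Fin.≟ v′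
  ... | yes refl = star⇒paw
    ((v≢x ∷ v≢y ∷ v′≢x′ ∷ v′≢y′ ∷ []) ∷ (apart vx vy α≢β ∷ apart vx v′x′ α≢γ ∷ apart vx v′y′ α≢δ ∷ []) ∷
     (apart vy v′x′ β≢γ ∷ apart vy v′y′ β≢δ ∷ []) ∷ (apart v′x′ v′y′ γ≢δ ∷ []) ∷ [] ∷ [])
    (unique₄ vx vy v′x′ v′y′ u)
  ... | no v≢v′ with injective⇒surjective (λ {i} {j} → lookup-injective u i j) (colour v v′)
  ... | 0F , α≡ = bridge⇒paw u v≢v′ v≢y v′≢x′ v′≢y′ (sym α≡) vy v′x′ v′y′
  ... | 1F , β≡ = bridge⇒paw
    ((≢-sym α≢β ∷ β≢γ ∷ β≢δ ∷ []) ∷ (α≢γ ∷ α≢δ ∷ []) ∷ (γ≢δ ∷ []) ∷ [] ∷ [])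
    v≢v′ v≢x v′≢x′ v′≢y′ (sym β≡) vx v′x′ v′y′
  ... | 2F , γ≡ = bridge⇒paw
    ((γ≢δ ∷ ≢-sym α≢γ ∷ ≢-sym β≢γ ∷ []) ∷ (≢-sym α≢δ ∷ ≢-sym β≢δ ∷ []) ∷ (α≢β ∷ []) ∷ [] ∷ [])
    (≢-sym v≢v′) v′≢y′ v≢x v≢y (trans (colour-sym v′ v) (sym γ≡)) v′y′ vx vy
  ... | 3F , δ≡ = bridge⇒paw
    ((≢-sym γ≢δ ∷ ≢-sym α≢δ ∷ ≢-sym β≢δ ∷ []) ∷ (≢-sym α≢γ ∷ ≢-sym β≢γ ∷ []) ∷ (α≢β ∷ []) ∷ [] ∷ [])
    (≢-sym v≢v′) v′≢x′ v≢x v≢y (trans (colour-sym v′ v) (sym δ≡)) v′x′ vx vy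

others : ∀ {d a b c : Fin 4} → Uniqueᵛ (d ∷ a ∷ b ∷ c ∷ []) → ∀ x → x ≢ d → x ≡ a ⊎ x ≡ b ⊎ x ≡ c
others u x x≢d with injective⇒surjective (λ {i} {j} → lookup-injective u i j) x
... | 0F , refl = ⊥-elim (x≢d refl)
... | 1F , refl = inj₁ refl
... | 2F , refl = inj₂ (inj₁ refl)
... | 3F , refl = inj₂ (inj₂ refl)

length-classes : ∀ {A : Set} {d a b c : Fin 4} → Uniqueᵛ (d ∷ a ∷ b ∷ c ∷ []) →
  (p : A → Fin 4) → (∀ x → p x ≢ d) → ∀ xs →
  length (filter (λ x → p x Fin.≟ a) xs) + length (filter (λ x → p x Fin.≟ b) xs) +
    length (filter (λ x → p x Fin.≟ c) xs) ≡ length xs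
length-classes _ p p≢d [] = refl
length-classes {a = a} {b} {c} u@(_ ∷ (a≢b ∷ a≢c ∷ []) ∷ (b≢c ∷ []) ∷ _) p p≢d (x ∷ xs)
  with p x Fin.≟ a | p x Fin.≟ b | p x Fin.≟ c | length-classes u p p≢d xs
... | yes refl | yes refl | _        | _ = ⊥-elim (a≢b refl)
... | yes refl | no _     | yes refl | _ = ⊥-elim (a≢c refl)
... | yes refl | no _     | no _     | ih = cong suc ih
... | no _     | yes refl | yes refl | _ = ⊥-elim (b≢c refl)
... | no _     | yes refl | no _     | ih =
  trans (cong (_+ length (filter (λ y → p y Fin.≟ c) xs)) (+-suc (length (filter (λ y → p y Fin.≟ a) xs)) (length (filter (λ y → p y Fin.≟ b) xs)))) (cong suc ih)
... | no _     | no _     | yes refl | ih = trans (+-suc (length (filter (λ y → p y Fin.≟ a) xs) + length (filter (λ y → p y Fin.≟ b) xs)) (length (filter (λ y → p y Fin.≟ c) xs))) (cong suc ih)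
... | no ≢a    | no ≢b    | no ≢c    | _ =
  ⊥-elim ([ ≢a , [ ≢b , ≢c ]′ ]′ (others u (p x) (p≢d x)))

-- Dominant colours

module Domination {n : ℕ} (χ : EdgeColoring 4 n) where
  open EdgeColoring χ
  open Stars χ
  open Rainbow χ
  open Structure χ

  Dominant : Fin 4 → Set
  Dominant d = ∀ v x y → v ≢ x → v ≢ y → colour v x ≢ d → colour v y ≢ d → colour v x ≡ colour v y

  no-cherries⇒dominant : ∀ {d a b c} → Uniqueᵛ (d ∷ a ∷ b ∷ c ∷ []) →
    ¬ Cherry a b → ¬ Cherry a c → ¬ Cherry b c → Dominant d
  no-cherries⇒dominant u ¬ab ¬ac ¬bc v x y v≢x v≢y ≢d ≢d′
    with others u (colour v x) ≢d | others u (colour v y) ≢d′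
  ... | inj₁ p        | inj₁ q        = trans p (sym q)
  ... | inj₁ p        | inj₂ (inj₁ q) = ⊥-elim (¬ab (v , x , y , (v≢x , v≢y) , p , q))
  ... | inj₁ p        | inj₂ (inj₂ q) = ⊥-elim (¬ac (v , x , y , (v≢x , v≢y) , p , q))
  ... | inj₂ (inj₁ p) | inj₁ q        = ⊥-elim (¬ab (v , y , x , (v≢y , v≢x) , q , p))
  ... | inj₂ (inj₁ p) | inj₂ (inj₁ q) = trans p (sym q)
  ... | inj₂ (inj₁ p) | inj₂ (inj₂ q) = ⊥-elim (¬bc (v , x , y , (v≢x , v≢y) , p , q))
  ... | inj₂ (inj₂ p) | inj₁ q        = ⊥-elim (¬ac (v , y , x , (v≢y , v≢x) , q , p))
  ... | inj₂ (inj₂ p) | inj₂ (inj₁ q) = ⊥-elim (¬bc (v , y , x , (v≢y , v≢x) , q , p))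
  ... | inj₂ (inj₂ p) | inj₂ (inj₂ q) = trans p (sym q)

  -- Exactness gives an edge `uv` of colour `c` and an edge `xy` of colour `d`. If they do not
  -- already meet in `u = x`, the edge `ux` forms a cherry with `xy` when it has colour `c`, and
  -- with `uv` otherwise.
  bichromatic-cherry : ∀ {c d} → c ≢ d → ∃ λ e → e ≢ c × Cherry c e
  bichromatic-cherry {c} {d} c≢d with exact c | exact d
  ... | u , v , u≢v , uv | x , y , x≢y , xy with u Fin.≟ x
  ... | yes refl = d , ≢-sym c≢d , u , v , y , (u≢v , x≢y) , uv , xy
  ... | no u≢x with colour u x Fin.≟ c
  ... | yes ux  = d , ≢-sym c≢d , x , u , y , (≢-sym u≢x , x≢y) , trans (colour-sym x u) ux , xy
  ... | no  ux≢ = colour u x , ux≢ , u , v , x , (u≢v , u≢x) , uv , refl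

  -- Excludes the case of `paw-or-dominant` in which one colour would be isolated.
  some-cherry : ∀ {d a b c} → Uniqueᵛ (d ∷ a ∷ b ∷ c ∷ []) → ¬ Cherry d a → ¬ Cherry d b → ¬ Cherry d c → ⊥
  some-cherry u@((d≢a ∷ _) ∷ _) ¬a ¬b ¬c with bichromatic-cherry d≢a
  ... | e , e≢d , ch with others u e e≢d
  ... | inj₁ refl        = ¬a ch
  ... | inj₂ (inj₁ refl) = ¬b ch
  ... | inj₂ (inj₂ refl) = ¬c ch

  opposite? : ∀ {α β γ δ} → Uniqueᵛ (α ∷ β ∷ γ ∷ δ ∷ []) →
    (HasRainbowCopy χ P₅ ⊎ RainbowPaw) ⊎ (¬ Cherry α β ⊎ ¬ Cherry γ δ)
  opposite? {α} {β} {γ} {δ} u with Cherry? α β | Cherry? γ δ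
  ... | yes c | yes c′ = inj₁ (disjoint-cherries⇒paw u c c′)
  ... | no ¬c | _      = inj₂ (inj₁ ¬c)
  ... | yes _ | no ¬c  = inj₂ (inj₂ ¬c)

  -- Six colour pairs form three opposite pairs. If from each one a pair has no cherry, the three
  -- missing pairs are either a star, which isolates a colour, or a triangle, which makes the
  -- remaining colour dominant.
  paw-or-dominant : (HasRainbowCopy χ P₅ ⊎ RainbowPaw) ⊎ ∃ Dominant
  paw-or-dominant
    with opposite? {0F} {1F} {2F} {3F} distinct
       | opposite? {0F} {2F} {1F} {3F} distinct
       | opposite? {0F} {3F} {1F} {2F} distinct
  ... | inj₁ r | _      | _      = inj₁ r
  ... | inj₂ _ | inj₁ r | _      = inj₁ r
  ... | inj₂ _ | inj₂ _ | inj₁ r = inj₁ r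
  ... | inj₂ (inj₁ ¬01) | inj₂ (inj₁ ¬02) | inj₂ (inj₁ ¬03) =
    ⊥-elim (some-cherry {0F} distinct ¬01 ¬02 ¬03)
  ... | inj₂ (inj₁ ¬01) | inj₂ (inj₁ ¬02) | inj₂ (inj₂ ¬12) =
    inj₂ (3F , no-cherries⇒dominant distinct ¬01 ¬02 ¬12)
  ... | inj₂ (inj₁ ¬01) | inj₂ (inj₂ ¬13) | inj₂ (inj₁ ¬03) =
    inj₂ (2F , no-cherries⇒dominant distinct ¬01 ¬03 ¬13)
  ... | inj₂ (inj₁ ¬01) | inj₂ (inj₂ ¬13) | inj₂ (inj₂ ¬12) =
    ⊥-elim (some-cherry {1F} distinct (¬01 ∘ Cherry-sym) ¬12 ¬13)
  ... | inj₂ (inj₂ ¬23) | inj₂ (inj₁ ¬02) | inj₂ (inj₁ ¬03) =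
    inj₂ (1F , no-cherries⇒dominant distinct ¬02 ¬03 ¬23)
  ... | inj₂ (inj₂ ¬23) | inj₂ (inj₁ ¬02) | inj₂ (inj₂ ¬12) =
    ⊥-elim (some-cherry {2F} distinct (¬02 ∘ Cherry-sym) (¬12 ∘ Cherry-sym) ¬23)
  ... | inj₂ (inj₂ ¬23) | inj₂ (inj₂ ¬13) | inj₂ (inj₁ ¬03) =
    ⊥-elim (some-cherry {3F} distinct (¬03 ∘ Cherry-sym) (¬13 ∘ Cherry-sym) (¬23 ∘ Cherry-sym))
  ... | inj₂ (inj₂ ¬23) | inj₂ (inj₂ ¬13) | inj₂ (inj₂ ¬12) =
    inj₂ (0F , no-cherries⇒dominant distinct ¬12 ¬13 ¬23)

  module Classes {d : Fin 4} (dominant : Dominant d) {e : Fin 4} (e≢d : e ≢ d) where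
    -- The colour other than d seen at v; vertices that see only d are put in the class of e.
    minor-at : ∀ v → ∃ λ c → c ≢ d × (∀ w → v ≢ w → colour v w ≢ d → colour v w ≡ c)
    minor-at v with any? (λ w → ¬? (v Fin.≟ w) ×-dec ¬? (colour v w Fin.≟ d))
    ... | yes (w , v≢w , ≢d) = colour v w , ≢d , λ x v≢x ≢d′ → dominant v x w v≢x v≢w ≢d′ ≢d
    ... | no  ∄w             = e , e≢d , λ w v≢w ≢d → ⊥-elim (∄w (w , v≢w , ≢d))

    minor : Fin n → Fin 4
    minor v = proj₁ (minor-at v)

    minor≢d : ∀ v → minor v ≢ d
    minor≢d v = proj₁ (proj₂ (minor-at v))

    minor-colour : ∀ {v w} → v ≢ w → colour v w ≢ d → colour v w ≡ minor v
    minor-colour {v} {w} = proj₂ (proj₂ (minor-at v)) w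

    class : Fin 4 → List (Fin n)
    class a = filter (λ v → minor v Fin.≟ a) (allFin n)

    class-minor : ∀ a → All (λ v → minor v ≡ a) (class a)
    class-minor a = All.all-filter _ (allFin n)

    class-unique : ∀ a → Unique (class a)
    class-unique a = Unique.filter⁺ _ (Unique.allFin⁺ n)

    -- An edge of another colour than `d` would show the minor colour of both of its ends.
    cross : ∀ {x y a b} → a ≢ b → minor x ≡ a → minor y ≡ b → colour x y ≡ d
    cross {x} {y} a≢b xa yb = decidable-stable (colour x y Fin.≟ d) λ ≢d →
      a≢b (trans (sym xa) (trans (sym (minor-colour x≢y ≢d))
        (trans (colour-sym x y) (trans (minor-colour (≢-sym x≢y) (≢d ∘ trans (colour-sym x y))) yb))))
      where
      x≢y : x ≢ y
      x≢y refl = a≢b (trans (sym xa) yb)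

    -- No class is empty: an edge of colour `c` exists by exactness, and its ends have `c` as minor
    -- colour. The smallest class can thus supply the centre.
    representative : ∀ {c} → c ≢ d → ∃ λ v → minor v ≡ c
    representative {c} c≢d with exact c
    ... | v , w , v≢w , vw =
      v , trans (sym (minor-colour v≢w (λ vw≡d → c≢d (trans (sym vw) vw≡d)))) vw

    -- The centre lies in the smallest class and the leaves in the other two. `3 * t ≤ 2 * n + 4`
    -- provides enough leaves, `t + 2 * r ≤ 2 + n` the trade-off between matching and clique in
    -- `dominated-copy`.
    classes-copy : ∀ {t r a b c} → Uniqueᵛ (d ∷ a ∷ b ∷ c ∷ []) →
      length (class b) ≤ length (class a) → length (class c) ≤ length (class b) →
      suc (2 * r) ≤ t → 3 * t ≤ 2 * n + 4 → t + 2 * r ≤ 2 + n →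
      HasMonochromaticCopy χ (S t r)
    classes-copy {t} {r} {a} {b} {c} u@((_ ∷ _ ∷ d≢c ∷ []) ∷ (a≢b ∷ a≢c ∷ []) ∷ (b≢c ∷ []) ∷ _)
      b≤a c≤b 2r<t 3t≤ tr≤ with representative (≢-sym d≢c)
    ... | v , v∈c = dominated-copy {d = a} (class a) (class b) unique
      (All.++⁺ (All.map (cross (≢-sym a≢c) v∈c) (class-minor a)) (All.map (cross (≢-sym b≢c) v∈c) (class-minor b)))
      (All.map (λ xa → All.map (cross a≢b xa) (class-minor b)) (class-minor a))
      (within (class-unique a) (class-minor a))
      b≤a t≤ 2r<t tr≤′
      where
      open ≤-Reasoning
      sizes : length (class a) + length (class b) + length (class c) ≡ n
      sizes = trans (length-classes u minor minor≢d (allFin n)) (length-tabulate _)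

      ∉class : ∀ {e′} → c ≢ e′ → All (v ≢_) (class e′)
      ∉class c≢e = All.map (λ xe → λ { refl → c≢e (trans (sym v∈c) xe) }) (class-minor _)

      unique : Unique (v ∷ class a ++ class b)
      unique = All.++⁺ (∉class (≢-sym a≢c)) (∉class (≢-sym b≢c)) ∷
        Unique.++⁺ (class-unique a) (class-unique b)
          (λ (x∈a , x∈b) → a≢b (trans (sym (All.lookup (class-minor a) x∈a)) (All.lookup (class-minor b) x∈b)))

      within : ∀ {M} → Unique M → All (λ x → minor x ≡ a) M →
        AllPairs (λ x y → colour x y ≢ d → colour x y ≡ a) M
      within []        _         = []
      within (x≢ ∷ u′) (xa ∷ as) = All.map (λ x≢y ≢d → trans (minor-colour x≢y ≢d) xa) x≢ ∷ within u′ as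

      -- Twice the smallest class is at most the sum `s` of the other two, so `2 * n ≤ 3 * s`; then
      -- `s + 2 ≤ t` would give `3 * t ≥ 3 * s + 6 > 2 * n + 4`.
      t≤ : t ≤ suc (length (class a) + length (class b))
      t≤ = ≮⇒≥ λ a+b<t → <-irrefl refl (begin-strict
        2 * n + 4 ≡⟨ cong (λ m → 2 * m + 4) sizes ⟨
        2 * (length (class a) + length (class b) + length (class c)) + 4
          ≡⟨ regroup (length (class a)) (length (class b)) (length (class c)) ⟩
        (2 * (length (class a) + length (class b)) + (length (class c) + length (class c))) + 4
          ≤⟨ +-monoˡ-≤ 4 (+-monoʳ-≤ (2 * (length (class a) + length (class b))) (+-mono-≤ (≤-trans c≤b b≤a) c≤b)) ⟩
        (2 * (length (class a) + length (class b)) + (length (class a) + length (class b))) + 4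
          <⟨ +-monoʳ-< _ (s≤s (≤-refl {4})) ⟩
        (2 * (length (class a) + length (class b)) + (length (class a) + length (class b))) + 5
          ≤⟨ +-monoʳ-≤ _ (n≤1+n 5) ⟩
        (2 * (length (class a) + length (class b)) + (length (class a) + length (class b))) + 6
          ≡⟨ triple (length (class a) + length (class b)) ⟩
        3 * suc (suc (length (class a) + length (class b))) ≤⟨ *-monoʳ-≤ 3 a+b<t ⟩
        3 * t ≤⟨ 3t≤ ⟩
        2 * n + 4 ∎)
        where
        regroup : ∀ i j k → 2 * (i + j + k) + 4 ≡ (2 * (i + j) + (k + k)) + 4
        regroup = solve-∀
        triple : ∀ i → (2 * i + i) + 6 ≡ 3 * suc (suc i)
        triple = solve-∀

      tr≤′ : t + 2 * r ≤ 2 + length (class a) + 2 * length (class b)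
      tr≤′ = begin
        t + 2 * r ≤⟨ tr≤ ⟩
        2 + n     ≡⟨ cong (2 +_) sizes ⟨
        2 + (length (class a) + length (class b) + length (class c))
          ≤⟨ +-monoʳ-≤ 2 (+-monoʳ-≤ (length (class a) + length (class b)) c≤b) ⟩
        2 + (length (class a) + length (class b) + length (class b))
          ≡⟨ regroup (length (class a)) (length (class b)) ⟩
        2 + length (class a) + 2 * length (class b) ∎
        where
        regroup : ∀ i j → 2 + (i + j + j) ≡ 2 + i + 2 * j
        regroup = solve-∀

  dominant⇒copy : ∀ {t r} → ∃ Dominant → suc (2 * r) ≤ t → 3 * t ≤ 2 * n + 4 → t + 2 * r ≤ 2 + n →
    HasMonochromaticCopy χ (S t r)
  dominant⇒copy {t} {r} (d , dominant) 2r<t 3t≤ tr≤ with minors d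
    where
    minors : ∀ d → ∃₂ λ a b → ∃ λ c → Uniqueᵛ (d ∷ a ∷ b ∷ c ∷ [])
    minors 0F = 1F , 2F , 3F , distinct
    minors 1F = 0F , 2F , 3F , distinct
    minors 2F = 0F , 1F , 3F , distinct
    minors 3F = 0F , 1F , 2F , distinct
  ... | a , b , c , ((d≢a ∷ d≢b ∷ d≢c ∷ []) ∷ (a≢b ∷ a≢c ∷ []) ∷ (b≢c ∷ []) ∷ _) =
    sorted (≤-total (size a) (size b)) (≤-total (size b) (size c)) (≤-total (size a) (size c))
    where
    open Classes dominant (≢-sym d≢a)

    size : Fin 4 → ℕ
    size e = length (class e)

    ordered : ∀ {a b c} → d ≢ a → d ≢ b → d ≢ c → a ≢ b → a ≢ c → b ≢ c →
      size b ≤ size a → size c ≤ size b → HasMonochromaticCopy χ (S t r)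
    ordered d≢a d≢b d≢c a≢b a≢c b≢c b≤a c≤b = classes-copy
      ((d≢a ∷ d≢b ∷ d≢c ∷ []) ∷ (a≢b ∷ a≢c ∷ []) ∷ (b≢c ∷ []) ∷ [] ∷ []) b≤a c≤b 2r<t 3t≤ tr≤

    sorted : size a ≤ size b ⊎ size b ≤ size a → size b ≤ size c ⊎ size c ≤ size b →
      size a ≤ size c ⊎ size c ≤ size a → HasMonochromaticCopy χ (S t r)
    sorted (inj₁ a≤b) (inj₁ b≤c) _ =
      ordered d≢c d≢b d≢a (≢-sym b≢c) (≢-sym a≢c) (≢-sym a≢b) b≤c a≤b
    sorted (inj₁ a≤b) (inj₂ c≤b) (inj₁ a≤c) =
      ordered d≢b d≢c d≢a b≢c (≢-sym a≢b) (≢-sym a≢c) c≤b a≤c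
    sorted (inj₁ a≤b) (inj₂ c≤b) (inj₂ c≤a) =
      ordered d≢b d≢a d≢c (≢-sym a≢b) b≢c a≢c a≤b c≤a
    sorted (inj₂ b≤a) (inj₁ b≤c) (inj₁ a≤c) =
      ordered d≢c d≢a d≢b (≢-sym a≢c) (≢-sym b≢c) a≢b a≤c b≤a
    sorted (inj₂ b≤a) (inj₁ b≤c) (inj₂ c≤a) =
      ordered d≢a d≢c d≢b a≢c a≢b (≢-sym b≢c) c≤a b≤c
    sorted (inj₂ b≤a) (inj₂ c≤b) _ =
      ordered d≢a d≢b d≢c a≢b a≢c b≢c b≤a c≤b

  -- The two last inequalities say that `n` is at least `(3t - 4)/2` and at least `t + 2r - 2`, so
  -- both ranges of `r` are treated at once.
  upper-bound : ∀ {t r} → 3 ≤ r → suc (2 * r) ≤ t → 3 * t ≤ 2 * n + 4 → t + 2 * r ≤ 2 + n →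
    HasRainbowCopy χ P₅ ⊎ HasMonochromaticCopy χ (S t r)
  upper-bound {t} {r} 3≤r 2r<t 3t≤ tr≤ with paw-or-dominant
  ... | inj₁ (inj₁ rainbow) = inj₁ rainbow
  ... | inj₁ (inj₂ paw)     = paw⇒copy paw t+3≤n 2r<t
    where
    open ≤-Reasoning
    -- The room for the triangle of the paw comes from `3 ≤ r`: `t + 6 ≤ t + 2 * r ≤ 2 + n`.
    t+3≤n : t + 3 ≤ n
    t+3≤n = +-cancelˡ-≤ 2 (t + 3) n (begin
      2 + (t + 3) ≡⟨ +-comm 2 (t + 3) ⟩
      t + 3 + 2   ≡⟨ +-assoc t 3 2 ⟩
      t + 5       ≤⟨ +-monoʳ-≤ t (n≤1+n 5) ⟩
      t + 6       ≤⟨ +-monoʳ-≤ t (*-monoʳ-≤ 2 3≤r) ⟩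
      t + 2 * r   ≤⟨ tr≤ ⟩
      2 + n       ∎)
  ... | inj₂ dominant = inj₂ (dominant⇒copy dominant 2r<t 3t≤ tr≤)

-- Extremal colourings

-- Two vertices in each class make the three inner colours occur, as exactness demands.
module Tripartite {n : ℕ} {σ : Fin 3 → ℕ} (parts : Fin n ↔ Σ (Fin 3) (Fin ∘ σ)) (large : ∀ d → 2 ≤ σ d) where
  open Inverse parts using (to; from; strictlyInverseˡ; strictlyInverseʳ)

  part : Fin n → Fin 3
  part i = proj₁ (to i)

  hue : Fin n → Fin n → Fin 4
  hue i j with part i Fin.≟ part j
  ... | yes _ = suc (part i)
  ... | no  _ = 0F

  inside : ∀ {i j} → part i ≡ part j → hue i j ≡ suc (part i)
  inside {i} {j} i~j with part i Fin.≟ part j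
  ... | yes _  = refl
  ... | no i≁j = ⊥-elim (i≁j i~j)

  across : ∀ {i j} → part i ≢ part j → hue i j ≡ 0F
  across {i} {j} i≁j with part i Fin.≟ part j
  ... | yes i~j = ⊥-elim (i≁j i~j)
  ... | no  _   = refl

  across⁻ : ∀ {i j} → hue i j ≡ 0F → part i ≢ part j
  across⁻ eq i~j with trans (sym eq) (inside i~j)
  ... | ()

  inside⁻ : ∀ {i j d} → hue i j ≡ suc d → part i ≡ d × part j ≡ d
  inside⁻ {i} {j} eq with part i Fin.≟ part j
  inside⁻ refl | yes i~j = refl , sym i~j

  hue-sym : ∀ i j → hue i j ≡ hue j i
  hue-sym i j = by-parts (part i Fin.≟ part j)
    where
    by-parts : _ → hue i j ≡ hue j i
    by-parts (yes i~j) = trans (inside i~j) (trans (cong suc i~j) (sym (inside (sym i~j))))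
    by-parts (no  i≁j) = trans (across i≁j) (sym (across (≢-sym i≁j)))

  first second : Fin 3 → Fin n
  first  d = from (d , fromℕ< (≤-trans z<s (large d)))
  second d = from (d , fromℕ< (large d))

  part-first : ∀ d → part (first d) ≡ d
  part-first d = cong proj₁ (strictlyInverseˡ _)

  part-second : ∀ d → part (second d) ≡ d
  part-second d = cong proj₁ (strictlyInverseˡ _)

  first≢second : ∀ d → first d ≢ second d
  first≢second d eq = 0≢1+n (trans (sym (Fin.toℕ-fromℕ< _))
    (trans (index (trans (sym (strictlyInverseˡ _)) (trans (cong to eq) (strictlyInverseˡ _)))) (Fin.toℕ-fromℕ< (large d))))
    where
    index : ∀ {x y : Σ (Fin 3) (Fin ∘ σ)} → x ≡ y → toℕ (proj₂ x) ≡ toℕ (proj₂ y)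
    index refl = refl

  colouring : EdgeColoring 4 n
  colouring = record { colour = hue ; colour-sym = hue-sym ; exact = exact }
    where
    exact : ∀ c → ∃₂ λ i j → i ≢ j × hue i j ≡ c
    exact zero = first 0F , first 1F , (λ eq → apart (cong part eq)) , across apart
      where
      apart : part (first 0F) ≢ part (first 1F)
      apart eq with trans (sym (part-first 0F)) (trans eq (part-first 1F))
      ... | ()
    exact (suc d) = first d , second d , first≢second d ,
      trans (inside (trans (part-first d) (sym (part-second d)))) (cong suc (part-first d))

  -- Of two consecutive edges at least one has colour 0, since otherwise both lie inside one class
  -- and agree in colour. The first two and the last two edges of the path therefore both contribute
  -- an edge of colour 0.
  ¬rainbow-path : ¬ HasRainbowCopy colouring P₅
  ¬rainbow-path (f , R) with crossing {0F} {1F} {2F} (inj₁ refl) (inj₁ refl) (λ ())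
                           | crossing {2F} {3F} {4F} (inj₁ refl) (inj₁ refl) (λ ())
    where
    open Injection f using () renaming (to to v)
    crossing : ∀ {a b c} → Graph.Adj P₅ a b → Graph.Adj P₅ b c → a ≢ c →
      hue (v a) (v b) ≡ 0F ⊎ hue (v b) (v c) ≡ 0F
    crossing {a} {b} {c} ab bc a≢c with part (v a) Fin.≟ part (v b) | part (v b) Fin.≟ part (v c)
    ... | no  a≁b | _       = inj₁ refl
    ... | yes _   | no  b≁c = inj₂ refl
    ... | yes a~b | yes b~c = ⊥-elim ([ (λ (a≡b , b≡c) → a≢c (trans a≡b b≡c)) , (λ (a≡c , _) → a≢c a≡c) ]′
      (R a b b c ab bc (trans (inside a~b) (trans (cong suc a~b) (sym (inside b~c))))))
  ... | inj₁ p | inj₁ q = [ (λ ()) , (λ ()) ]′ (R 0F 1F 2F 3F (inj₁ refl) (inj₁ refl) (trans p (sym q)))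
  ... | inj₁ p | inj₂ q = [ (λ ()) , (λ ()) ]′ (R 0F 1F 3F 4F (inj₁ refl) (inj₁ refl) (trans p (sym q)))
  ... | inj₂ p | inj₁ q = [ (λ ()) , (λ ()) ]′ (R 1F 2F 2F 3F (inj₁ refl) (inj₁ refl) (trans p (sym q)))
  ... | inj₂ p | inj₂ q = [ (λ ()) , (λ ()) ]′ (R 1F 2F 3F 4F (inj₁ refl) (inj₁ refl) (trans p (sym q)))

  to-injective : ∀ {i j} → to i ≡ to j → i ≡ j
  to-injective eq = trans (sym (strictlyInverseʳ _)) (trans (cong from eq) (strictlyInverseʳ _))

  crowd : ∀ {k d} (g : Fin k → Fin n) → Injective _≡_ _≡_ g → (∀ i → part (g i) ≡ d) → k ≤ σ d
  crowd {d = d} g g-inj g∈d = Fin.injective⇒≤ {f = λ i → index (to (g i)) (g∈d i)}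
    (λ {i} {j} eq → g-inj (to-injective (index-injective (to (g i)) (to (g j)) (g∈d i) (g∈d j) eq)))
    where
    index : (x : Σ (Fin 3) (Fin ∘ σ)) → proj₁ x ≡ d → Fin (σ d)
    index (_ , a) refl = a

    index-injective : ∀ x y (p : proj₁ x ≡ d) (q : proj₁ y ≡ d) → index x p ≡ index y q → x ≡ y
    index-injective (_ , _) (_ , _) refl refl refl = refl

  -- A star in an inner colour stays inside one class, which has fewer than `t` vertices. Only
  -- colour 0 depends on the class sizes in a finer way and is left to the hypothesis.
  ¬monochromatic-star : ∀ {t r} → 2 ≤ t → (∀ d → σ d < t) →
    ((f : Fin t → Fin n) → Injective _≡_ _≡_ f → (∀ a b → Graph.Adj (S t r) a b → part (f a) ≢ part (f b)) → ⊥) →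
    ¬ HasMonochromaticCopy colouring (S t r)
  ¬monochromatic-star _ _ ¬across (f , zero , M) =
    ¬across to′ injective (λ a b ab → across⁻ (M a b ab))
    where open Injection f using (injective) renaming (to to to′)
  ¬monochromatic-star {suc (suc t)} _ σ<t _ (f , suc d , M) =
    <⇒≱ (σ<t d) (crowd to′ injective in-d)
    where
    open Injection f using (injective) renaming (to to to′)
    in-d : ∀ i → part (to′ i) ≡ d
    in-d zero    = proj₁ (inside⁻ (M zero (suc zero) (inj₁ (inj₁ (refl , z<s)))))
    in-d (suc i) = proj₂ (inside⁻ (M zero (suc i) (inj₁ (inj₁ (refl , z<s)))))
  ¬monochromatic-star {suc zero} (s≤s ())

equal-parts : ∀ m → Fin (3 * m) ↔ Σ (Fin 3) (λ _ → Fin m)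
equal-parts m = Fin.*↔×

module Equal (m r : ℕ) (2≤m : 2 ≤ m) where
  open Tripartite (equal-parts m) (λ _ → 2≤m) public

  -- The leaves of a star of colour 0 avoid the class of its centre, hence number at most 2m.
  ¬star : ¬ HasMonochromaticCopy colouring (S (suc (suc (2 * m))) r)
  ¬star = ¬monochromatic-star (s≤s (s≤s z≤n)) (λ _ → s≤s (m≤n⇒m≤1+n (m≤m+n m _)))
    λ f f-inj differ → 1+n≰n (Fin.injective⇒≤ {f = λ j → leaf f differ j} (λ eq →
      Fin.suc-injective (f-inj (leaf-injective f differ eq))))
    where
    module _ (f : Fin (suc (suc (2 * m))) → Fin (3 * m))
             (differ : ∀ a b → Graph.Adj (S (suc (suc (2 * m))) r) a b → part (f a) ≢ part (f b)) where
      centre≢ : ∀ j → part (f zero) ≢ part (f (suc j))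
      centre≢ j = differ zero (suc j) (inj₁ (inj₁ (refl , z<s)))

      -- `punchOut` numbers the class of the leaf among the two classes that avoid the centre; the
      -- index within the class completes the code.
      leaf : Fin (suc (2 * m)) → Fin (2 * m)
      leaf j = combine (punchOut (centre≢ j)) (proj₂ (remQuot {3} m (f (suc j))))

      leaf-injective : ∀ {i j} → leaf i ≡ leaf j → f (suc i) ≡ f (suc j)
      leaf-injective {i} {j} eq with Fin.combine-injective _ _ _ _ eq
      ... | p , q = to-injective (cong₂ _,_ (Fin.punchOut-injective (centre≢ i) (centre≢ j) p) q)

skewed : ℕ → ℕ → Fin 3 → ℕ
skewed x y 0F = x
skewed x y 1F = y
skewed x y 2F = y

skewed-parts : ∀ x y → Fin (x + (y + y)) ↔ Σ (Fin 3) (Fin ∘ skewed x y)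
skewed-parts x y = mk↔ₛ′ to from to-from from-to
  where
  to : Fin (x + (y + y)) → Σ (Fin 3) (Fin ∘ skewed x y)
  to i = [ (0F ,_) , (λ j → [ (1F ,_) , (2F ,_) ]′ (splitAt y j)) ]′ (splitAt x i)

  from : Σ (Fin 3) (Fin ∘ skewed x y) → Fin (x + (y + y))
  from (0F , a) = a ↑ˡ (y + y)
  from (1F , a) = x ↑ʳ (a ↑ˡ y)
  from (2F , a) = x ↑ʳ (y ↑ʳ a)

  to-from : ∀ d → to (from d) ≡ d
  to-from (0F , a) rewrite Fin.splitAt-↑ˡ x a (y + y) = refl
  to-from (1F , a) rewrite Fin.splitAt-↑ʳ x (y + y) (a ↑ˡ y) | Fin.splitAt-↑ˡ y a y = refl
  to-from (2F , a) rewrite Fin.splitAt-↑ʳ x (y + y) (y ↑ʳ a) | Fin.splitAt-↑ʳ y y a = refl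

  from-to : ∀ i → from (to i) ≡ i
  from-to i with splitAt x i in eq
  ... | inj₁ a = Fin.splitAt⁻¹-↑ˡ eq
  ... | inj₂ j with splitAt y j in eq′
  ... | inj₁ a = trans (cong (x ↑ʳ_) (Fin.splitAt⁻¹-↑ˡ eq′)) (Fin.splitAt⁻¹-↑ʳ eq)
  ... | inj₂ a = trans (cong (x ↑ʳ_) (Fin.splitAt⁻¹-↑ʳ eq′)) (Fin.splitAt⁻¹-↑ʳ eq)

⌊2*m/2⌋ : ∀ m → ⌊ 2 * m /2⌋ ≡ m
⌊2*m/2⌋ zero    = refl
⌊2*m/2⌋ (suc m) rewrite *-suc 2 m = cong suc (⌊2*m/2⌋ m)

⌊1+2*m/2⌋ : ∀ m → ⌊ suc (2 * m) /2⌋ ≡ m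
⌊1+2*m/2⌋ zero    = refl
⌊1+2*m/2⌋ (suc m) rewrite +-suc m (m + 0) = cong suc (⌊1+2*m/2⌋ m)

-- Here `t = suc x` and `r = suc y`, so the bound on `x` is `2 * r + 1 ≤ t`: all added edges fit
-- into the star.
module Skewed (x y : ℕ) (2≤y : 2 ≤ y) (2r≤x : 2 * suc y ≤ x) where
  y≤x : y ≤ x
  y≤x = ≤-trans (n≤1+n y) (≤-trans (m≤m+n (suc y) _) 2r≤x)

  large : ∀ d → 2 ≤ skewed x y d
  large 0F = ≤-trans 2≤y y≤x
  large 1F = 2≤y
  large 2F = 2≤y

  small : ∀ d → skewed x y d < suc x
  small 0F = ≤-refl
  small 1F = s≤s y≤x
  small 2F = s≤s y≤x

  open Tripartite (skewed-parts x y) large public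

  small-part : ∀ e → ∃ λ d → d ≢ e × skewed x y d ≡ y
  small-part 0F = 1F , (λ ()) , refl
  small-part 1F = 2F , (λ ()) , refl
  small-part 2F = 1F , (λ ()) , refl


  -- Only two classes differ from `e`, and `a` and `b` fill both of them.
  third : ∀ (d e a b : Fin 3) → d ≢ e → e ≢ a → e ≢ b → a ≢ b → a ≡ d ⊎ b ≡ d
  third = from-yes (Fin.all? {3} λ d → Fin.all? {3} λ e → Fin.all? {3} λ a → Fin.all? {3} λ b →
    ¬? (d Fin.≟ e) →-dec (¬? (e Fin.≟ a) →-dec (¬? (e Fin.≟ b) →-dec (¬? (a Fin.≟ b) →-dec
      (a Fin.≟ d ⊎-dec b Fin.≟ d)))))

  -- In a copy of colour 0, each added edge has an end in the class d of size y other than that of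
  -- the centre, so there are at most y added edges.
  ¬star : ¬ HasMonochromaticCopy colouring (S (suc x) (suc y))
  ¬star = ¬monochromatic-star (s≤s (≤-trans (<⇒≤ 2≤y) y≤x)) small too-many
    where
    too-many : (f : Fin (suc x) → Fin (x + (y + y))) → Injective _≡_ _≡_ f →
      (∀ a b → Graph.Adj (S (suc x) (suc y)) a b → part (f a) ≢ part (f b)) → ⊥
    too-many f f-inj differ with small-part (part (f zero))
    ... | d , d≢ , size≡y = 1+n≰n (subst (suc y ≤_) size≡y
      (crowd (λ m → f (proj₁ (end m))) end-injective (λ m → proj₁ (proj₂ (end m)))))
      where
      spoke : ∀ {a : Fin (suc x)} k → toℕ a ≡ suc k → part (f zero) ≢ part (f a)
      spoke k a≡ = differ zero _ (inj₁ (inj₁ (refl , ≤-trans z<s (≤-reflexive (sym a≡)))))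

      -- The ends sit at positions `1 + 2m` and `2 + 2m`, so halving the position less one recovers
      -- `m`: ends of different added edges are different.
      end : ∀ (m : Fin (suc y)) → ∃ λ a → part (f a) ≡ d × ⌊ toℕ a ∸ 1 /2⌋ ≡ toℕ m
      end m = [ (λ p → odd , p , trans (cong (λ k → ⌊ k ∸ 1 /2⌋) odd≡) (⌊2*m/2⌋ (toℕ m)))
              , (λ p → even , p , trans (cong (λ k → ⌊ k ∸ 1 /2⌋) even≡) (⌊1+2*m/2⌋ (toℕ m))) ]′
              (third d (part (f zero)) (part (f odd)) (part (f even)) d≢ (spoke (2 * toℕ m) odd≡)
                (spoke (suc (2 * toℕ m)) even≡) (differ odd even (inj₁ (inj₂ (m , odd≡ , even≡)))))
        where
        even< : 2 + 2 * toℕ m < suc x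
        even< = s≤s (≤-trans (≤-reflexive (sym (*-suc 2 (toℕ m)))) (≤-trans (*-monoʳ-≤ 2 (Fin.toℕ<n m)) 2r≤x))
        odd even : Fin (suc x)
        odd  = fromℕ< (<⇒≤ even<)
        even = fromℕ< even<
        odd≡ : toℕ odd ≡ 1 + 2 * toℕ m
        odd≡ = Fin.toℕ-fromℕ< (<⇒≤ even<)
        even≡ : toℕ even ≡ 2 + 2 * toℕ m
        even≡ = Fin.toℕ-fromℕ< even<

      end-injective : ∀ {m m′} → f (proj₁ (end m)) ≡ f (proj₁ (end m′)) → m ≡ m′
      end-injective {m} {m′} eq = Fin.toℕ-injective (trans (sym (proj₂ (proj₂ (end m))))
        (trans (cong (λ a → ⌊ toℕ a ∸ 1 /2⌋) (f-inj eq)) (proj₂ (proj₂ (end m′)))))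

-- The value of the Gallai-Ramsey number

n≤[1+n]C2 : ∀ n → n ≤ suc n C 2
n≤[1+n]C2 n = ≤-trans (≤-reflexive (sym (nC1≡n n)))
  (≤-trans (m≤m+n (n C 1) (n C 2)) (≤-reflexive (nCk+nC[k+1]≡[n+1]C[k+1] n 1)))

-- A bound speaks of all larger orders too, so the single bad colouring of order `n` refutes every
-- bound `N′ ≤ n`.
gallai-ramsey : ∀ {t r n} → 4 ≤ n → (χ : EdgeColoring 4 n) →
  ¬ HasRainbowCopy χ P₅ → ¬ HasMonochromaticCopy χ (S t r) →
  3 ≤ r → suc (2 * r) ≤ t → 3 * t ≤ 2 * suc n + 4 → t + 2 * r ≤ 2 + suc n →
  IsGallaiRamseyNumber 4 P₅ (S t r) (suc n)
gallai-ramsey {t} {r} {n} 4≤n χ ¬rainbow ¬mono 3≤r 2r<t 3t≤ tr≤ =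
  (≤-trans 4≤n (n≤[1+n]C2 n) , λ n′ n<n′ χ′ → Domination.upper-bound χ′ 3≤r 2r<t
    (≤-trans 3t≤ (+-monoˡ-≤ 4 (*-monoʳ-≤ 2 n<n′))) (≤-trans tr≤ (+-monoʳ-≤ 2 n<n′))) ,
  λ N′ (_ , bound) → ≰⇒> λ N′≤n → [ ¬rainbow , ¬mono ]′ (bound n N′≤n χ)

-- With `t = 2m + 2` and `N = 3m + 1`, the inequality `3 * t ≤ 2 * N + 4` is an equality, and
-- `2 * r ≤ suc m` yields `t + 2 * r ≤ 2 + N`.
gallai-ramsey-equal : ∀ r m → 3 ≤ r → 2 * r ≤ suc m →
  IsGallaiRamseyNumber 4 P₅ (S (suc (suc (2 * m))) r) (suc (3 * m))
gallai-ramsey-equal r m 3≤r 2r≤ =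
  gallai-ramsey (≤-trans (n≤1+n 4) (≤-trans 5≤m (m≤m+n m _))) colouring ¬rainbow-path ¬star 3≤r
    (s≤s (≤-trans 2r≤ (s≤s (m≤m+n m _)))) (≤-reflexive (six m))
    (≤-trans (+-monoʳ-≤ (suc (suc (2 * m))) 2r≤) (≤-reflexive (three m)))
  where
  5≤m : 5 ≤ m
  5≤m = ≤-pred (≤-trans (*-monoʳ-≤ 2 3≤r) 2r≤)
  open Equal m r (≤-trans (s≤s (s≤s z≤n)) 5≤m)
  six : ∀ m → 3 * suc (suc (2 * m)) ≡ 2 * suc (3 * m) + 4
  six = solve-∀
  three : ∀ m → suc (suc (2 * m)) + suc m ≡ 2 + suc (3 * m)
  three = solve-∀

-- Now `t + 2 * r ≤ 2 + N` is the equality, and `t ≤ 4 * r` yields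
-- `3 * t ≤ 2 * t + 4 * r = 2 * N + 4`.
gallai-ramsey-skewed : ∀ x y → 3 ≤ suc y → 2 * suc y < x → suc x ≤ 4 * suc y →
  IsGallaiRamseyNumber 4 P₅ (S (suc x) (suc y)) (suc (x + (y + y)))
gallai-ramsey-skewed x y 3≤r 2r<x t≤4r =
  gallai-ramsey (≤-trans 4≤x (m≤m+n x (y + y))) colouring ¬rainbow-path ¬star 3≤r
    (<⇒≤ (s≤s 2r<x)) 3t≤ (≤-reflexive (two x y))
  where
  4≤x : 4 ≤ x
  4≤x = ≤-trans (≤-trans (m≤n+m 4 2) (*-monoʳ-≤ 2 3≤r)) (<⇒≤ 2r<x)
  open Skewed x y (≤-pred 3≤r) (<⇒≤ 2r<x)
  two : ∀ x y → suc x + 2 * suc y ≡ 2 + suc (x + (y + y))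
  two = solve-∀
  four : ∀ x y → 2 * suc x + 4 * suc y ≡ 2 * suc (x + (y + y)) + 4
  four = solve-∀
  3t≤ : 3 * suc x ≤ 2 * suc (x + (y + y)) + 4
  3t≤ = ≤-trans (≤-reflexive (+-comm (suc x) (2 * suc x)))
    (≤-trans (+-monoʳ-≤ (2 * suc x) t≤4r) (≤-reflexive (four x y)))

theorem3p5 : (r t : ℕ) → 3 ≤ r → 2 ∣ t →
    (r ≤ t / 4 →
    IsGallaiRamseyNumber 4 P₅ (S t r) ((3 * t ∸ 4) / 2))
    × (⌈ t / 4 ⌉ ≤ r → r ≤ (t ∸ 2) / 2 →
    IsGallaiRamseyNumber 4 P₅ (S t r) (t + 2 * r ∸ 2))
theorem3p5 r t 3≤r (divides s refl) = few s , many r (s * 2) 3≤r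
  where
  few : ∀ s → r ≤ s * 2 / 4 → IsGallaiRamseyNumber 4 P₅ (S (s * 2) r) ((3 * (s * 2) ∸ 4) / 2)
  few zero    r≤ with ≤-trans 3≤r r≤
  ... | ()
  -- With `t = 2m + 2`, the bound `4 * r ≤ t` halves to `2 * r ≤ suc m`.
  few (suc m) r≤ rewrite *-comm m 2 = subst (IsGallaiRamseyNumber 4 P₅ (S (suc (suc (2 * m))) r)) (sym value)
    (gallai-ramsey-equal r m 3≤r (*-cancelʳ-≤ (2 * r) (suc m) 2 (begin
      2 * r * 2                ≡⟨ quadruple r ⟩
      r * 4                    ≤⟨ *-monoˡ-≤ 4 r≤ ⟩
      suc (suc (2 * m)) / 4 * 4 ≤⟨ m/n*n≤m (suc (suc (2 * m))) 4 ⟩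
      suc (suc (2 * m))        ≡⟨ cong (2 +_) (*-comm 2 m) ⟩
      suc m * 2                ∎)))
    where
    open ≤-Reasoning
    quadruple : ∀ r → 2 * r * 2 ≡ r * 4
    quadruple = solve-∀
    six : ∀ m → 3 * suc (suc (2 * m)) ≡ suc (3 * m) * 2 + 4
    six = solve-∀
    value : (3 * suc (suc (2 * m)) ∸ 4) / 2 ≡ suc (3 * m)
    value = trans (cong (λ k → (k ∸ 4) / 2) (six m))
      (trans (cong (_/ 2) (m+n∸n≡m (suc (3 * m) * 2) 4)) (m*n/n≡m (suc (3 * m)) 2))

  many : ∀ r t → 3 ≤ r → ⌈ t / 4 ⌉ ≤ r → r ≤ (t ∸ 2) / 2 →
    IsGallaiRamseyNumber 4 P₅ (S t r) (t + 2 * r ∸ 2)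
  many (suc y) zero          3≤r _ r≤ with ≤-trans 3≤r r≤
  ... | ()
  many (suc y) (suc zero)    3≤r _ r≤ with ≤-trans 3≤r r≤
  ... | ()
  many (suc y) (suc (suc x)) 3≤r ≤r r≤ =
    subst (IsGallaiRamseyNumber 4 P₅ (S (suc (suc x)) (suc y))) (sym value)
      (gallai-ramsey-skewed (suc x) y 3≤r (s≤s 2r≤x) t≤4r)
    where
    open ≤-Reasoning
    2r≤x : 2 * suc y ≤ x
    2r≤x = begin
      2 * suc y ≡⟨ *-comm 2 (suc y) ⟩
      suc y * 2 ≤⟨ *-monoˡ-≤ 2 r≤ ⟩
      x / 2 * 2 ≤⟨ m/n*n≤m x 2 ⟩
      x         ∎

    -- If `4 * r < t`, then `4 * (r + 1) ≤ t + 3`, so the rounded-up quarter of `t` would exceed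
    -- `r`.
    t≤4r : suc (suc x) ≤ 4 * suc y
    t≤4r = ≮⇒≥ λ 4r<t → <⇒≱ (≤-trans (s≤s ≤r) (quotient 4r<t)) ≤-refl
      where
      quotient : 4 * suc y < suc (suc x) → suc (suc y) ≤ (suc (suc x) + 3) / 4
      quotient 4r<t = begin
        suc (suc y)           ≡⟨ m*n/n≡m (suc (suc y)) 4 ⟨
        suc (suc y) * 4 / 4   ≤⟨ /-monoˡ-≤ 4 (begin
          suc (suc y) * 4     ≡⟨ regroup y ⟩
          suc (4 * suc y) + 3 ≤⟨ +-monoˡ-≤ 3 4r<t ⟩
          suc (suc x) + 3     ∎) ⟩
        (suc (suc x) + 3) / 4 ∎
        where
        regroup : ∀ y → suc (suc y) * 4 ≡ suc (4 * suc y) + 3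
        regroup = solve-∀

    value : suc (suc x) + 2 * suc y ∸ 2 ≡ suc (suc x + (y + y))
    value = cong (_∸ 2) (sum x y)
      where
      sum : ∀ x y → suc (suc x) + 2 * suc y ≡ 2 + suc (suc x + (y + y))
      sum = solve-∀
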